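{- Let $k\geqslant 4$ and $n\geqslant 64k$ be integers. Then \[ R_k(P_n)\leqslant \left(k-\frac{1}{4}+\frac{1}{2k}\right)n\,. \]
   Context: $P_n$ denotes the path on $n$ vertices. For a graph $F$, the Ramsey number $R_k(F)$ is the least integer $N$ such that every colouring of the edges of the complete graph $K_N$ with $k$ colours contains a monochromatic copy of $F$. -}

module Defs where

open import Data.Nat using (ℕ; suc)
import Data.Nat
import Data.Fin
open import Data.Fin using (Fin; inject₁; _≟_)
open import Data.Product using (Σ; ∃; _×_)
open import Function.Definitions using (Injective)
open import Relation.Binary.PropositionalEquality using (_≡_)
open import Relation.Nullary using (¬_)

-- A k-edge-colouring of the complete graph K_N on vertex set Fin N:
-- a colour for every unordered pair {u,v}, u ≢ v (encoded as a symmetric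
-- function; the value on the diagonal is irrelevant).
record Colouring (k N : ℕ) : Set where
  field
    col : Fin N → Fin N → Fin k
    sym : ∀ u v → col u v ≡ col v u
open Colouring public

MonoPath : ∀ {k N} → Colouring k N → (m : ℕ) → Set
MonoPath {k} {N} c m =
  Σ (Fin k) λ a →
  Σ (Fin m → Fin N) λ f →
    Injective _≡_ _≡_ f ×
    (∀ (i : Fin m) (j : Fin m) → Data.Fin.toℕ j ≡ suc (Data.Fin.toℕ i) →
       col c (f i) (f j) ≡ a)

Arrows : (k m N : ℕ) → Set
Arrows k m N = (c : Colouring k N) → MonoPath c m

{-# OPTIONS --safe #-}
-- A graph on N vertices without P_n has at most nN ordered adjacent pairs, while K_N has
-- N² − N, so the k colours together fall short of k·nN by about (k − 9/4 + 1/k) n²/4 pairs.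
--
-- In one colour, delete vertices of degree < n/2 as long as possible.  The components of the
-- rest have minimum degree ≥ n/2, so closing up a longest path shows that they have fewer
-- than n vertices.  By a Bondy–Chvátal closure argument, a deleted vertex with more than
-- n − |S| neighbours in such a cluster S can be added to S, which then still has a Hamiltonian
-- cycle and hence never reaches n vertices.  A vertex that is never added has few neighbours
-- in the clusters, so those deleted last had small degree; it follows that the colour falls
-- short by n²/4 ("sparse") unless at most n vertices were deleted ("clustered").
--
-- Two clustered colours each have at most k clusters.  The pairs lying in a cluster of both
-- colours, at least about n²/4 of them, cannot be used twice.  So all colours but one cost
-- about n²/4, and (k − 1) n²/4 exceeds the available total.
module Submission where

open import Defs hiding (sym)
open import Data.Bool using (Bool; true; false; not; _∧_; _∨_)
open import Data.Empty using (⊥; ⊥-elim)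
open import Data.Fin.Base as Fin using (Fin)
import Data.Fin.Properties as Fin
open import Data.Fin.Properties using (all?; any?)
open import Data.List using (List; []; _∷_; _++_; length; concat; map; lookup; allFin)
import Data.List.Membership.DecPropositional as DecMembership
open import Data.List.Membership.Propositional using (_∈_)
open import Data.List.Membership.Propositional.Properties using (∈-++⁺ˡ; ∈-++⁺ʳ; ∈-∃++; ∈-lookup)
open import Data.List.Properties using (length-++; ++-assoc; ++-identityʳ; map-tabulate; length-tabulate)
open import Data.List.Relation.Binary.Permutation.Propositional as Perm using (_↭_; ↭-refl; ↭-reflexive; ↭-sym; ↭-trans; prep)
open import Data.List.Relation.Binary.Permutation.Propositional.Properties using (∈-resp-↭; ↭-length; shift; shifts; ++-comm; ++⁺ˡ; ++⁺ʳ)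
open import Data.List.Relation.Unary.All using (All; []; _∷_) renaming (map to All-map)
open import Data.List.Relation.Unary.Any using (here; there)
open import Data.Nat as ℕ hiding (_≟_)
open import Data.Nat.DivMod using (_/_; _%_; m/n*n≤m; m≡m%n+[m/n]*n; m%n<n)
open import Data.Nat.Properties hiding (_≟_)
open import Data.Nat.Tactic.RingSolver using (solve-∀)
open import Data.Product using (Σ; ∃; _×_; _,_; proj₁)
open import Data.Sum using (_⊎_; inj₁; inj₂; [_,_]′)
open import Data.Unit using (⊤; tt)
open import Function using (_∘_; id)
open import Relation.Binary.Definitions using (DecidableEquality)
open import Relation.Binary.PropositionalEquality using (_≡_; _≢_; refl; sym; trans; cong; cong₂; subst; subst₂; module ≡-Reasoning)
open import Relation.Nullary using (¬_; Dec; yes; no; does)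
open import Relation.Nullary.Decidable using (dec-true; dec-false; map′; _×-dec_)

-- The overlaps must not be paid for once per pair of colours, so a single clustered colour `a₀`
-- serves as base. Another clustered colour may itself own some pairs of its overlap with the
-- clusters of `a₀`; these are charged to `inside a`. The colour classes are disjoint, so all
-- charges, including that of `a₀`, fit into the pairs within clusters of `a₀`, and the budget n N
-- of one colour covers them. Only `a₀` brings no deficit, hence the factor k - 1. Two clustered
-- colours have at least N - 2n vertices in clusters of both, spread over at most k² intersections.
-- Their squares are bounded below by the tangent to p² at p = n/(2k), which is near the average
-- size of an intersection when k = 4. This is the tight place: the deficit obtained is n²/4 -
-- 3n²/(4k²), with a 3 dictated by k = 4. To stay within the natural numbers, edges are counted as
-- ordered pairs and the final inequalities are multiplied by 4k².

⟦_⟧ : Bool → ℕ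
⟦ true ⟧ = 1
⟦ false ⟧ = 0

⟦⟧≤1 : ∀ b → ⟦ b ⟧ ≤ 1
⟦⟧≤1 true = ≤-refl
⟦⟧≤1 false = z≤n

+-interchange : ∀ a b c d → a + b + (c + d) ≡ a + c + (b + d)
+-interchange = solve-∀

+-swap-last : ∀ a b c → a + b + c ≡ a + c + b
+-swap-last = solve-∀

-- Finite sums over lists

module _ {A : Set} where

  ∑ : (A → ℕ) → List A → ℕ
  ∑ f [] = 0
  ∑ f (x ∷ l) = f x + ∑ f l

  ∑-++ : ∀ f l m → ∑ f (l ++ m) ≡ ∑ f l + ∑ f m
  ∑-++ f [] m = refl
  ∑-++ f (x ∷ l) m = trans (cong (f x +_) (∑-++ f l m)) (sym (+-assoc (f x) _ _))

  ∑-↭ : ∀ f {l m} → l ↭ m → ∑ f l ≡ ∑ f m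
  ∑-↭ f Perm.refl = refl
  ∑-↭ f (Perm.prep x p) = cong (f x +_) (∑-↭ f p)
  ∑-↭ f (Perm.swap {l} {m} x y p) = begin
    f x + (f y + ∑ f l) ≡⟨ +-assoc (f x) (f y) _ ⟨
    f x + f y + ∑ f l   ≡⟨ cong₂ _+_ (+-comm (f x) (f y)) (∑-↭ f p) ⟩
    f y + f x + ∑ f m   ≡⟨ +-assoc (f y) (f x) _ ⟩
    f y + (f x + ∑ f m) ∎
    where open ≡-Reasoning
  ∑-↭ f (Perm.trans p q) = trans (∑-↭ f p) (∑-↭ f q)

  ∑-mono-∈ : ∀ {f g} l → (∀ {x} → x ∈ l → f x ≤ g x) → ∑ f l ≤ ∑ g l
  ∑-mono-∈ [] h = z≤n
  ∑-mono-∈ (x ∷ l) h = +-mono-≤ (h (here refl)) (∑-mono-∈ l (h ∘ there))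

  ∑-mono : ∀ {f g} l → (∀ x → f x ≤ g x) → ∑ f l ≤ ∑ g l
  ∑-mono l h = ∑-mono-∈ l (λ {x} _ → h x)

  ∑-cong : ∀ {f g} l → (∀ x → f x ≡ g x) → ∑ f l ≡ ∑ g l
  ∑-cong [] h = refl
  ∑-cong (x ∷ l) h = cong₂ _+_ (h x) (∑-cong l h)

  ∑-+ : ∀ f g l → ∑ (λ x → f x + g x) l ≡ ∑ f l + ∑ g l
  ∑-+ f g [] = refl
  ∑-+ f g (x ∷ l) rewrite ∑-+ f g l = +-interchange (f x) (g x) (∑ f l) (∑ g l)

  ∑-*ˡ : ∀ c f l → ∑ (λ x → c * f x) l ≡ c * ∑ f l
  ∑-*ˡ c f [] = sym (*-zeroʳ c)
  ∑-*ˡ c f (x ∷ l) rewrite ∑-*ˡ c f l = sym (*-distribˡ-+ c (f x) (∑ f l))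

  ∑-*ʳ : ∀ c f l → ∑ (λ x → f x * c) l ≡ ∑ f l * c
  ∑-*ʳ c f [] = refl
  ∑-*ʳ c f (x ∷ l) rewrite ∑-*ʳ c f l = sym (*-distribʳ-+ c (f x) (∑ f l))

  ∑-const : ∀ c l → ∑ (λ _ → c) l ≡ length l * c
  ∑-const c [] = refl
  ∑-const c (x ∷ l) = cong (c +_) (∑-const c l)

  ∑-one : ∀ l → ∑ (λ _ → 1) l ≡ length l
  ∑-one l = trans (∑-const 1 l) (*-identityʳ (length l))

  ∑≡0 : ∀ {f} l → (∀ {x} → x ∈ l → f x ≡ 0) → ∑ f l ≡ 0
  ∑≡0 [] h = refl
  ∑≡0 (x ∷ l) h = cong₂ _+_ (h (here refl)) (∑≡0 l (h ∘ there))

  ∑-member : ∀ f {x l} → x ∈ l → f x ≤ ∑ f l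
  ∑-member f (here refl) = m≤m+n _ _
  ∑-member f (there {y} p) = ≤-trans (∑-member f p) (m≤n+m _ (f y))

∑-concat : ∀ {A : Set} f (ls : List (List A)) → ∑ f (concat ls) ≡ ∑ (∑ f) ls
∑-concat f [] = refl
∑-concat f (l ∷ ls) = trans (∑-++ f l (concat ls)) (cong (∑ f l +_) (∑-concat f ls))

∑-swap : ∀ {A B : Set} (f : A → B → ℕ) l m →
         ∑ (λ x → ∑ (f x) m) l ≡ ∑ (λ y → ∑ (λ x → f x y) l) m
∑-swap f [] m = sym (∑≡0 m (λ _ → refl))
∑-swap f (x ∷ l) m rewrite ∑-swap f l m = sym (∑-+ (f x) _ m)

search : ∀ {A : Set} (p : A → Bool) l →
         (∃ λ X → ∃ λ y → ∃ λ Y → l ≡ X ++ y ∷ Y × p y ≡ true) ⊎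
         (∀ {y} → y ∈ l → p y ≡ false)
search p [] = inj₂ λ ()
search p (x ∷ l) with p x in px
... | true = inj₁ ([] , x , l , refl , px)
... | false with search p l
...   | inj₁ (X , y , Y , refl , py) = inj₁ (x ∷ X , y , Y , refl , py)
...   | inj₂ none = inj₂ λ { (here refl) → px ; (there q) → none q }

-- Walks

module Walk {A : Set} where

  end : A → List A → A
  end x [] = x
  end x (y ∷ l) = end y l

  back : A → List A → List A
  back x [] = []
  back x (y ∷ l) = back y l ++ x ∷ []

  preds : A → List A → List A
  preds x [] = []
  preds x (y ∷ l) = x ∷ preds y l

  end-++ : ∀ x l m → end x (l ++ m) ≡ end (end x l) m
  end-++ x [] m = refl
  end-++ x (y ∷ l) m = end-++ y l m

  end-back : ∀ x l → end (end x l) (back x l) ≡ x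
  end-back x [] = refl
  end-back x (y ∷ l) = end-++ (end y l) (back y l) (x ∷ [])

  end-∈ : ∀ x l → end x l ∈ x ∷ l
  end-∈ x [] = here refl
  end-∈ x (y ∷ l) = there (end-∈ y l)

  back-↭ : ∀ x l → end x l ∷ back x l ↭ x ∷ l
  back-↭ x [] = ↭-refl
  back-↭ x (y ∷ l) =
    ↭-trans (++⁺ʳ (x ∷ []) (back-↭ y l)) (++-comm (y ∷ l) (x ∷ []))

  ∑-preds : ∀ f x l → ∑ f (preds x l) + f (end x l) ≡ ∑ f (x ∷ l)
  ∑-preds f x [] = sym (+-identityʳ (f x))
  ∑-preds f x (y ∷ l) =
    trans (+-assoc (f x) _ _) (cong (f x +_) (∑-preds f y l))

  rotate-↭ : ∀ (x : A) X y Y → y ∷ Y ++ x ∷ X ↭ x ∷ X ++ y ∷ Y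
  rotate-↭ x X y Y = ++-comm (y ∷ Y) (x ∷ X)

  -- A walk is given by its first vertex x and the list l of the following ones;
  -- closed also counts the step from its end back to x.
  module Defects (E : A → A → Bool) where

    b : A → A → ℕ
    b u v = ⟦ not (E u v) ⟧

    b-edge : ∀ {u v} → E u v ≡ true → b u v ≡ 0
    b-edge eq rewrite eq = refl

    defects : A → List A → ℕ
    defects x [] = 0
    defects x (y ∷ l) = b x y + defects y l

    closed : A → List A → ℕ
    closed x l = defects x l + b (end x l) x

    defects-++ : ∀ x l m → defects x (l ++ m) ≡ defects x l + defects (end x l) m
    defects-++ x [] m = refl
    defects-++ x (y ∷ l) m =
      trans (cong (b x y +_) (defects-++ y l m)) (sym (+-assoc (b x y) _ _))

    find-defect : ∀ x l → 0 < defects x l →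
      ∃ λ X → ∃ λ y → ∃ λ Y → l ≡ X ++ y ∷ Y × E (end x X) y ≡ false
    find-defect x (y ∷ l) pos with E x y in eq
    ... | false = [] , y , l , refl , eq
    ... | true with find-defect y l pos
    ...   | X , z , Y , refl , h = y ∷ X , z , Y , refl , h

    closed-rotate : ∀ x X y Y → closed y (Y ++ x ∷ X) ≡ closed x (X ++ y ∷ Y)
    closed-rotate x X y Y
      rewrite defects-++ y Y (x ∷ X) | defects-++ x X (y ∷ Y)
            | end-++ y Y (x ∷ X) | end-++ x X (y ∷ Y)
      = cyc (defects y Y) (b (end y Y) x) (defects x X) (b (end x X) y)
      where
      cyc : ∀ p q r s → p + (q + r) + s ≡ r + (s + p) + q
      cyc = solve-∀

    rotate-to : ∀ {u} x l → u ∈ x ∷ l →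
      ∃ λ m → u ∷ m ↭ x ∷ l × closed u m ≡ closed x l
    rotate-to x l (here refl) = l , ↭-refl , refl
    rotate-to {u} x l (there u∈l) = go l u∈l
      where
      go : ∀ l → u ∈ l → ∃ λ m → u ∷ m ↭ x ∷ l × closed u m ≡ closed x l
      go l u∈l with ∈-∃++ u∈l
      ... | X , Y , refl = Y ++ x ∷ X , rotate-↭ x X u Y , closed-rotate x X u Y

    module Symmetric (E-sym : ∀ u v → E u v ≡ E v u) where

      b-sym : ∀ u v → b u v ≡ b v u
      b-sym u v = cong (⟦_⟧ ∘ not) (E-sym u v)

      defects-back : ∀ x l → defects (end x l) (back x l) ≡ defects x l
      defects-back x [] = refl
      defects-back x (y ∷ l)
        rewrite defects-++ (end y l) (back y l) (x ∷ [])
              | end-back y l | defects-back y l | b-sym y x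
        = trans (cong (defects y l +_) (+-identityʳ (b x y))) (+-comm (defects y l) (b x y))

      -- The step from `end x X` to `y` and the closing step are traded for two edges, and the part
      -- from `y` on is run backwards. The bound omits the old closing step: if that was a defect,
      -- the count drops; if the walk was a path, a cycle results.
      closed-two-opt : ∀ x X y Y → E x y ≡ true → E (end y Y) (end x X) ≡ true →
        closed x (X ++ end y Y ∷ back y Y) ≤ defects x (X ++ y ∷ Y)
      closed-two-opt x X y Y exy eva
        rewrite defects-++ x X (end y Y ∷ back y Y) | defects-++ x X (y ∷ Y)
              | end-++ x X (end y Y ∷ back y Y) | end-back y Y
              | b-sym (end x X) (end y Y) | b-edge eva | b-sym y x | b-edge exy
              | defects-back y Y
              | +-identityʳ (defects x X + defects y Y)
        = +-monoʳ-≤ (defects x X) (m≤n+m _ _)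

  two-opt-↭ : ∀ (x : A) X y Y → x ∷ X ++ end y Y ∷ back y Y ↭ x ∷ X ++ y ∷ Y
  two-opt-↭ x X y Y = prep x (++⁺ˡ X (back-↭ y Y))

  module Degree (E : A → A → Bool) where

    deg : A → List A → ℕ
    deg u l = ∑ (λ v → ⟦ E u v ⟧) l

    -- Pigeonhole over the steps of the walk x , l.
    crossing-step : ∀ u v x l → length l < deg u l + deg v (preds x l) →
      ∃ λ X → ∃ λ y → ∃ λ Y →
      l ≡ X ++ y ∷ Y × E u y ≡ true × E v (end x X) ≡ true
    crossing-step u v x (y ∷ l) h with E u y in eu | E v x in ev
    ... | true | true = [] , y , l , refl , eu , ev
    ... | true | false with crossing-step u v y l (s≤s⁻¹ h)
    ...   | X , z , Y , refl , p , q = y ∷ X , z , Y , refl , p , q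
    crossing-step u v x (y ∷ l) h | false | true
      with crossing-step u v y l (s≤s⁻¹ (subst (suc (length l) <_) (+-suc (deg u l) _) h))
    ... | X , z , Y , refl , p , q = y ∷ X , z , Y , refl , p , q
    crossing-step u v x (y ∷ l) h | false | false
      with crossing-step u v y l (<-trans (n<1+n _) h)
    ... | X , z , Y , refl , p , q = y ∷ X , z , Y , refl , p , q

    -- Without loops, `x` has its neighbours among the heads of the `length l` steps and the end has
    -- its own among their tails. The degree sum exceeds the number of steps, so some step serves
    -- both. This is the exchange in the proofs of Dirac's and Ore's theorems.
    crossing : (∀ u → E u u ≡ false) → ∀ x l →
      length (x ∷ l) ≤ deg x (x ∷ l) + deg (end x l) (x ∷ l) →
      ∃ λ X → ∃ λ y → ∃ λ Y →
      l ≡ X ++ y ∷ Y × E x y ≡ true × E (end y Y) (end x X) ≡ true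
    crossing E-irrefl x l h with crossing-step x (end x l) x l h′
      where
      h′ : length l < deg x l + deg (end x l) (preds x l)
      h′ = subst (length (x ∷ l) ≤_)
             (cong₂ _+_ (cong (λ t → ⟦ t ⟧ + deg x l) (E-irrefl x))
               (trans (sym (∑-preds _ x l))
                 (trans (cong (λ t → deg (end x l) (preds x l) + ⟦ t ⟧) (E-irrefl (end x l)))
                   (+-identityʳ _)))) h
    ... | X , y , Y , refl , exy , eva rewrite end-++ x X (y ∷ Y) = X , y , Y , refl , exy , eva

open Walk
open Walk.Degree using (deg)

-- The Bondy–Chvátal closure step: a Hamiltonian cycle of E′ loses one non-edge of E
-- at each exchange.
module Closure {A : Set} (E E′ : A → A → Bool)
  (E-sym : ∀ u v → E u v ≡ E v u) (E-irrefl : ∀ u → E u u ≡ false)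
  (E′-sym : ∀ u v → E′ u v ≡ E′ v u) (E⊆E′ : ∀ u v → E u v ≡ true → E′ u v ≡ true) where

  open module D = Defects {A} E using (closed; defects; b)
  open module D′ = Defects {A} E′ using () renaming (closed to closed′; defects to defects′; b to b′)

  module _ (S : List A)
    (ore : ∀ {u v} → u ∈ S → v ∈ S → E′ u v ≡ true → E u v ≡ false →
           length S ≤ deg E u S + deg E v S) where

    b′≡0⇒edge : ∀ {u v} → b′ u v ≡ 0 → E′ u v ≡ true
    b′≡0⇒edge {u} {v} eq with E′ u v
    ... | true = refl

    -- The exchange is sure to remove a defect only at the closing step, so a non-edge is rotated
    -- there. Both counts belong to the cycle and do not depend on where it starts.
    defect-to-front : ∀ x l → 0 < closed x l →
      ∃ λ y → ∃ λ m → y ∷ m ↭ x ∷ l × E (end y m) y ≡ false ×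
      closed y m ≡ closed x l × closed′ y m ≡ closed′ x l
    defect-to-front x l pos with E (end x l) x in eq
    ... | false = x , l , ↭-refl , eq , cong (λ t → defects x l + ⟦ not t ⟧) eq , refl
    ... | true with D.find-defect x l (subst (0 <_) (+-identityʳ _) pos)
    ...   | X , y , Y , refl , bad =
      y , Y ++ x ∷ X , rotate-↭ x X y Y , subst (λ t → E t y ≡ false) (sym (end-++ y Y (x ∷ X))) bad ,
      trans (D.closed-rotate x X y Y) (cong (λ t → defects x (X ++ y ∷ Y) + ⟦ not t ⟧) eq) ,
      D′.closed-rotate x X y Y

    -- The invariant `closed′ x l ≡ 0` puts every defect in `E′`, where `ore` applies. It persists
    -- because an exchange brings in edges of `E` only, while the defect count, bounded by `f`,
    -- drops each time.
    repair : ∀ f x l → closed x l ≤ f → x ∷ l ↭ S → closed′ x l ≡ 0 →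
      ∃ λ y → ∃ λ m → y ∷ m ↭ S × closed y m ≡ 0
    repair f x l bnd perm c′ with closed x l in eqc
    repair f x l bnd perm c′ | zero = x , l , perm , eqc
    repair (suc f) x l (s≤s bnd) perm c′ | suc c
      with defect-to-front x l (subst (0 <_) (sym eqc) z<s)
    ... | y , m , y∷m↭ , bad , ceq , ceq′ with ore′
      where
      perm′ : y ∷ m ↭ S
      perm′ = ↭-trans y∷m↭ perm
      ore′ : length (y ∷ m) ≤ deg E y (y ∷ m) + deg E (end y m) (y ∷ m)
      ore′ = subst₂ _≤_ (sym (↭-length perm′))
             (trans (+-comm (deg E (end y m) S) (deg E y S))
               (cong₂ _+_ (∑-↭ _ (↭-sym perm′)) (∑-↭ _ (↭-sym perm′))))
             (ore (∈-resp-↭ perm′ (end-∈ y m)) (∈-resp-↭ perm′ (here refl))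
               (b′≡0⇒edge (m+n≡0⇒n≡0 (defects′ y m) (trans ceq′ c′))) bad)
    ... | h with Walk.Degree.crossing E E-irrefl y m h
    ...   | X , z , Y , refl , e₁ , e₂ =
      repair f y (X ++ end z Y ∷ back z Y)
        (≤-trans (D.Symmetric.closed-two-opt E-sym y X z Y e₁ e₂) dle)
        (↭-trans (two-opt-↭ y X z Y) (↭-trans y∷m↭ perm))
        (n≤0⇒n≡0 (≤-trans (D′.Symmetric.closed-two-opt E′-sym y X z Y (E⊆E′ _ _ e₁) (E⊆E′ _ _ e₂))
          (≤-trans (m≤m+n _ _) (≤-reflexive (trans ceq′ c′)))))
      where
      dle : defects y (X ++ z ∷ Y) ≤ f
      dle = s≤s⁻¹ (≤-trans (≤-reflexive (trans (+-comm 1 _)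
              (trans (cong (λ t → defects y (X ++ z ∷ Y) + ⟦ not t ⟧) (sym bad)) (trans ceq eqc))))
              (s≤s bnd))

does⇒ : ∀ {P : Set} (p? : Dec P) → does p? ≡ true → P
does⇒ (yes p) _ = p

does⇒¬ : ∀ {P : Set} (p? : Dec P) → does p? ≡ false → ¬ P
does⇒¬ (no ¬p) _ = ¬p

-- Multiplicities and lists without repetition

module Multiplicity {A : Set} (_≟_ : DecidableEquality A) where

  δ : A → A → ℕ
  δ u v = ⟦ does (u ≟ v) ⟧

  δ-refl : ∀ u → δ u u ≡ 1
  δ-refl u = cong ⟦_⟧ (dec-true (u ≟ u) refl)

  mult : A → List A → ℕ
  mult u = ∑ (δ u)

  ∈⇒1≤mult : ∀ {u l} → u ∈ l → 1 ≤ mult u l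
  ∈⇒1≤mult {u} u∈l = ≤-trans (≤-reflexive (sym (δ-refl u))) (∑-member (δ u) u∈l)

  -- Stated by counts, so that it passes along permutations by `∑-↭`.
  Distinct : List A → Set
  Distinct l = ∀ u → mult u l ≤ 1

  distinct-↭ : ∀ {l m} → l ↭ m → Distinct l → Distinct m
  distinct-↭ p d u = subst (_≤ 1) (∑-↭ (δ u) p) (d u)

  distinct-++ˡ : ∀ l m → Distinct (l ++ m) → Distinct l
  distinct-++ˡ l m d u =
    ≤-trans (m≤m+n _ _) (subst (_≤ 1) (∑-++ (δ u) l m) (d u))

  distinct-tail : ∀ x l → Distinct (x ∷ l) → Distinct l
  distinct-tail x l d u = ≤-trans (m≤n+m _ (δ u x)) (d u)

  distinct-head : ∀ {x v} l → Distinct (x ∷ l) → v ∈ l → x ≢ v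
  distinct-head {x} l d v∈l refl =
    <⇒≱ (s≤s (∈⇒1≤mult v∈l)) (subst (λ t → t + mult x l ≤ 1) (δ-refl x) (d x))

  complete-defects : ∀ E x l → Distinct (x ∷ l) →
    (∀ {u v} → u ∈ x ∷ l → v ∈ x ∷ l → u ≢ v → E u v ≡ true) →
    Defects.defects E x l ≡ 0
  complete-defects E x [] d h = refl
  complete-defects E x (y ∷ l) d h
    rewrite h (here refl) (there (here refl)) (distinct-head (y ∷ l) d (here refl))
    = complete-defects E y l (distinct-tail x (y ∷ l) d) (λ p q → h (there p) (there q))

  -- At least two vertices: `closed x []` tests the loop at `x`, a defect in a loopless graph,
  -- whereas two adjacent vertices pass for a cycle that runs along one edge and back.
  complete-closed : ∀ E x y l → Distinct (x ∷ y ∷ l) →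
    (∀ {u v} → u ∈ x ∷ y ∷ l → v ∈ x ∷ y ∷ l → u ≢ v → E u v ≡ true) →
    Defects.closed E x (y ∷ l) ≡ 0
  complete-closed E x y l d h =
    cong₂ _+_ (complete-defects E x (y ∷ l) d h)
      (Defects.b-edge E (h (there (end-∈ y l)) (here refl)
        (distinct-head (y ∷ l) d (end-∈ y l) ∘ sym)))

-- Degrees into a list

module _ {A : Set} (G : A → A → Bool) where

  deg-↭ : ∀ u {l m} → l ↭ m → deg G u l ≡ deg G u m
  deg-↭ u = ∑-↭ _

  deg-++ : ∀ u l m → deg G u (l ++ m) ≡ deg G u l + deg G u m
  deg-++ u = ∑-++ _

  deg-++-≥ˡ : ∀ u l m → deg G u l ≤ deg G u (l ++ m)
  deg-++-≥ˡ u l m = ≤-trans (m≤m+n _ _) (≤-reflexive (sym (deg-++ u l m)))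

  deg≤length : ∀ u l → deg G u l ≤ length l
  deg≤length u l = ≤-trans (∑-mono l (λ v → ⟦⟧≤1 (G u v))) (≤-reflexive (∑-one l))

  deg≡0 : ∀ u l → (∀ {v} → v ∈ l → G u v ≡ false) → deg G u l ≡ 0
  deg≡0 u l h = ∑≡0 l (λ v∈ → cong ⟦_⟧ (h v∈))

  deg-positive : ∀ u l → 0 < deg G u l → ∃ λ X → ∃ λ y → ∃ λ Y → l ≡ X ++ y ∷ Y × G u y ≡ true
  deg-positive u l pos with search (G u) l
  ... | inj₁ found = found
  ... | inj₂ none = ⊥-elim (<⇒≢ pos (sym (deg≡0 u l none)))

n≤2a∧n≤2b⇒n≤a+b : ∀ {n} a b → n ≤ 2 * a → n ≤ 2 * b → n ≤ a + b
n≤2a∧n≤2b⇒n≤a+b {n} a b p q =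
  *-cancelˡ-≤ 2 (≤-trans (≤-reflexive (cong (n +_) (+-identityʳ n)))
    (≤-trans (+-mono-≤ p q) (≤-reflexive (sym (*-distribˡ-+ 2 a b)))))

∨-introˡ : ∀ {a b} → a ≡ true → a ∨ b ≡ true
∨-introˡ refl = refl

∨-introʳ : ∀ a {b} → b ≡ true → a ∨ b ≡ true
∨-introʳ true _ = refl
∨-introʳ false eq = eq

-- Structure of graphs without a path on n vertices

module PathFree {A : Set} (_≟_ : DecidableEquality A)
  (G : A → A → Bool) (G-sym : ∀ u v → G u v ≡ G v u) (G-irrefl : ∀ u → G u u ≡ false)
  (n : ℕ) (2≤n : 2 ≤ n) (W : List A)
  (W-distinct : Multiplicity.Distinct _≟_ W)
  (free : ∀ x l R → W ↭ (x ∷ l) ++ R → Defects.defects G x l ≡ 0 → length (x ∷ l) ≢ n)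
  where

  open Multiplicity _≟_
  open DecMembership _≟_ using (_∈?_)
  open Defects G using (defects; closed)

  -- The diagonal is left out because in `absorb-step` this graph plays the role of `E` in
  -- `Closure`, which has to be loopless.
  fill : List A → A → A → Bool
  fill S u v = G u v ∨ (not (does (u ≟ v)) ∧ (does (u ∈? S) ∧ does (v ∈? S)))

  fill-G : ∀ S u v → G u v ≡ true → fill S u v ≡ true
  fill-G S u v = ∨-introˡ

  fill-∈ : ∀ {S u v} → u ∈ S → v ∈ S → u ≢ v → fill S u v ≡ true
  fill-∈ {S} {u} {v} p q u≢v
    rewrite dec-true (u ∈? S) p | dec-true (v ∈? S) q | dec-false (u ≟ v) u≢v
    = ∨-introʳ (G u v) refl

  fill⁻ : ∀ S u v → fill S u v ≡ true → G u v ≡ true ⊎ (u ∈ S × v ∈ S × u ≢ v)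
  fill⁻ S u v h with G u v | u ≟ v | u ∈? S | v ∈? S
  ... | true  | _      | _     | _     = inj₁ refl
  ... | false | no u≢v | yes p | yes q = inj₂ (p , q , u≢v)

  fill-sym : ∀ S u v → fill S u v ≡ fill S v u
  fill-sym S u v rewrite G-sym u v with u ≟ v | v ≟ u | u ∈? S | v ∈? S
  ... | yes _   | yes _   | _     | _     = refl
  ... | yes u≡v | no  v≢u | _     | _     = ⊥-elim (v≢u (sym u≡v))
  ... | no  u≢v | yes v≡u | _     | _     = ⊥-elim (u≢v (sym v≡u))
  ... | no  _   | no  _   | yes _ | yes _ = refl
  ... | no  _   | no  _   | yes _ | no _  = refl
  ... | no  _   | no  _   | no _  | yes _ = refl
  ... | no  _   | no  _   | no _  | no _  = refl

  fill-irrefl : ∀ S u → fill S u u ≡ false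
  fill-irrefl S u rewrite G-irrefl u | dec-true (u ≟ u) refl = refl

  -- S behaves like a clique as far as Hamiltonian cycles on at most n vertices
  -- are concerned.
  CliqueLike : List A → Set
  CliqueLike S = ∀ Y R → W ↭ (S ++ Y) ++ R → length (S ++ Y) ≤ n →
    ∀ x l → x ∷ l ↭ S ++ Y → Defects.closed (fill S) x l ≡ 0 →
    ∃ λ y → ∃ λ m → y ∷ m ↭ S ++ Y × closed y m ≡ 0

  -- Ore's condition: two vertices of `C` have at least n/2 neighbours each within `C`, together as
  -- many as `C ++ Y` has vertices. `fill C` adds no pair that meets `Y`, so only pairs within `C`
  -- have to be checked.
  half-degree⇒cliqueLike : ∀ C → (∀ {u} → u ∈ C → n ≤ 2 * deg G u C) → CliqueLike C
  half-degree⇒cliqueLike C big Y R W↭ len x l x∷l↭ cyc =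
    Closure.repair G (fill C) G-sym G-irrefl (fill-sym C) (fill-G C) (C ++ Y) ore
      _ x l ≤-refl x∷l↭ cyc
    where
    ore : ∀ {u v} → u ∈ C ++ Y → v ∈ C ++ Y → fill C u v ≡ true → G u v ≡ false →
          length (C ++ Y) ≤ deg G u (C ++ Y) + deg G v (C ++ Y)
    ore {u} {v} _ _ f g with fill⁻ C u v f
    ... | inj₁ g′ with () ← trans (sym g) g′
    ... | inj₂ (u∈C , v∈C , _) = ≤-trans len
      (≤-trans (n≤2a∧n≤2b⇒n≤a+b (deg G u C) (deg G v C) (big u∈C) (big v∈C))
        (+-mono-≤ (deg-++-≥ˡ G u C Y) (deg-++-≥ˡ G v C Y)))

  fill-degree : ∀ {S c} → Distinct S → c ∈ S → length S ≤ suc (deg (fill S) c S)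
  fill-degree {S} {c} dS c∈S = begin
    length S                                 ≡⟨ ∑-one S ⟨
    ∑ (λ _ → 1) S                            ≤⟨ ∑-mono-∈ S pointwise ⟩
    ∑ (λ v → δ c v + ⟦ fill S c v ⟧) S       ≡⟨ ∑-+ (δ c) _ S ⟩
    mult c S + deg (fill S) c S              ≤⟨ +-monoˡ-≤ _ (dS c) ⟩
    suc (deg (fill S) c S)                   ∎
    where
    open ≤-Reasoning
    pointwise : ∀ {v} → v ∈ S → 1 ≤ δ c v + ⟦ fill S c v ⟧
    pointwise {v} v∈S with c ≟ v
    ... | yes _ = s≤s z≤n
    ... | no c≢v rewrite dec-true (c ∈? S) c∈S | dec-true (v ∈? S) v∈S
                       | ∨-introʳ (G c v) {true} refl = ≤-refl

  -- In `fill S` the vertex `r` has degree above n - |S| and every vertex of `S` has degree at least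
  -- |S| - 1, together at least n. So the closure step leads from `fill (r ∷ S)` back to `fill S`,
  -- where `r` is one of the extra vertices; this is why `CliqueLike` admits an arbitrary `Y`.
  absorb-step : ∀ {S r} → n < deg G r S + length S → CliqueLike S → CliqueLike (r ∷ S)
  absorb-step {S} {r} many cl Y R W↭ len x l x∷l↭ cyc
    with Closure.repair (fill S) (fill (r ∷ S)) (fill-sym S) (fill-irrefl S) (fill-sym (r ∷ S))
           grow (r ∷ S ++ Y) ore _ x l ≤-refl x∷l↭ cyc
    where
    grow : ∀ u v → fill S u v ≡ true → fill (r ∷ S) u v ≡ true
    grow u v h with fill⁻ S u v h
    ... | inj₁ g = fill-G (r ∷ S) u v g
    ... | inj₂ (p , q , u≢v) = fill-∈ (there p) (there q) u≢v
    S-distinct : Distinct S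
    S-distinct = distinct-++ˡ S Y (distinct-tail r (S ++ Y)
                   (distinct-++ˡ (r ∷ S ++ Y) R (distinct-↭ W↭ W-distinct)))
    deg-r : deg G r S ≤ deg (fill S) r (r ∷ S ++ Y)
    deg-r = begin
      deg G r S                     ≤⟨ ∑-mono S (λ v → fill-≥ v) ⟩
      deg (fill S) r S              ≤⟨ deg-++-≥ˡ (fill S) r S Y ⟩
      deg (fill S) r (S ++ Y)       ≤⟨ m≤n+m _ _ ⟩
      deg (fill S) r (r ∷ S ++ Y)   ∎
      where
      open ≤-Reasoning
      fill-≥ : ∀ v → ⟦ G r v ⟧ ≤ ⟦ fill S r v ⟧
      fill-≥ v with G r v
      ... | true = ≤-refl
      ... | false = z≤n
    deg-c : ∀ {c} → c ∈ S → length S ≤ suc (deg (fill S) c (r ∷ S ++ Y))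
    deg-c {c} c∈S = ≤-trans (fill-degree S-distinct c∈S)
      (s≤s (≤-trans (deg-++-≥ˡ (fill S) c S Y) (m≤n+m _ _)))
    sum-bound : ∀ {c} → c ∈ S → length (r ∷ S ++ Y) ≤
                deg (fill S) r (r ∷ S ++ Y) + deg (fill S) c (r ∷ S ++ Y)
    sum-bound {c} c∈S = ≤-trans len (s≤s⁻¹ (≤-trans many
      (≤-trans (+-mono-≤ deg-r (deg-c c∈S)) (≤-reflexive (+-suc _ _)))))
    ore : ∀ {u v} → u ∈ r ∷ S ++ Y → v ∈ r ∷ S ++ Y →
          fill (r ∷ S) u v ≡ true → fill S u v ≡ false →
          length (r ∷ S ++ Y) ≤ deg (fill S) u (r ∷ S ++ Y) + deg (fill S) v (r ∷ S ++ Y)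
    ore {u} {v} _ _ f g with fill⁻ (r ∷ S) u v f
    ... | inj₁ guv with () ← trans (sym g) (fill-G S u v guv)
    ... | inj₂ (here refl , here refl , u≢v) = ⊥-elim (u≢v refl)
    ... | inj₂ (here refl , there q , _) = sum-bound q
    ... | inj₂ (there p , here refl , _) =
      ≤-trans (sum-bound p) (≤-reflexive (+-comm (deg (fill S) r (r ∷ S ++ Y)) _))
    ... | inj₂ (there p , there q , u≢v) with () ← trans (sym g) (fill-∈ {S} p q u≢v)
  ... | y , m , y∷m↭ , cyc′
    with cl (r ∷ Y) R (↭-trans W↭ (++⁺ʳ R (↭-sym (shift r S Y))))
            (≤-trans (≤-reflexive (↭-length (shift r S Y))) len)
            y m (↭-trans y∷m↭ (↭-sym (shift r S Y))) cyc′
  ... | z , k , z∷k↭ , cyc″ = z , k , ↭-trans z∷k↭ (shift r S Y) , cyc″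

  -- For empty `Y` the graph `fill S` is complete on `S`, so `G` has a Hamiltonian cycle there.
  -- Without its closing step, a cycle on n vertices would be a forbidden path.
  cliqueLike-short : ∀ S R → W ↭ S ++ R → CliqueLike S → length S ≢ n
  cliqueLike-short [] R W↭ cl len = <⇒≢ (≤-trans (s≤s z≤n) 2≤n) len
  cliqueLike-short (x ∷ []) R W↭ cl len = <⇒≢ 2≤n len
  cliqueLike-short S@(x ∷ y ∷ l) R W↭ cl len
    with cl [] R (↭-trans W↭ (++⁺ʳ R (↭-reflexive (sym (++-identityʳ S)))))
            (≤-reflexive (trans (cong length (++-identityʳ S)) len))
            x (y ∷ l) (↭-reflexive (sym (++-identityʳ S)))
            (complete-closed (fill S) x y l (distinct-++ˡ S R (distinct-↭ W↭ W-distinct)) fill-∈)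
  ... | z , m , z∷m↭ , cyc =
    free z m R (↭-trans W↭ (++⁺ʳ R (↭-sym z∷m↭S))) (m+n≡0⇒m≡0 _ cyc) (trans (↭-length z∷m↭S) len)
    where
    z∷m↭S : z ∷ m ↭ S
    z∷m↭S = ↭-trans z∷m↭ (↭-reflexive (++-identityʳ S))

  -- From fewer than n vertices one more leads to at most n, and n itself is excluded by
  -- `cliqueLike-short`; so the cluster stays short until no vertex qualifies.
  absorb : ∀ f R c P → length R ≤ f → W ↭ c ++ R ++ P → CliqueLike c → length c < n →
    ∃ λ X → ∃ λ T → R ↭ X ++ T × length (X ++ c) < n ×
    (∀ {t} → t ∈ T → deg G t (X ++ c) + length (X ++ c) ≤ n)
  absorb f R c P len W↭ cl c<n with search (λ r → does (n <? deg G r c + length c)) R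
  ... | inj₂ none = [] , R , ↭-refl , c<n , λ t∈ → ≮⇒≥ (does⇒¬ (n <? _) (none t∈))
  absorb zero .(X ++ r ∷ Y) c P len W↭ cl c<n | inj₁ (X , r , Y , refl , many)
    with () ← subst (_≤ 0) (↭-length (shift r X Y)) len
  absorb (suc f) .(X ++ r ∷ Y) c P len W↭ cl c<n | inj₁ (X , r , Y , refl , many)
    with absorb f (X ++ Y) (r ∷ c) P
           (s≤s⁻¹ (subst (_≤ suc f) (↭-length (shift r X Y)) len)) W↭′ cl′ r∷c<n
    where
    W↭′ : W ↭ (r ∷ c) ++ (X ++ Y) ++ P
    W↭′ = ↭-trans W↭ (↭-trans (++⁺ˡ c (++⁺ʳ P (shift r X Y))) (shift r c ((X ++ Y) ++ P)))
    cl′ : CliqueLike (r ∷ c)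
    cl′ = absorb-step (does⇒ (n <? _) many) cl
    r∷c<n : length (r ∷ c) < n
    r∷c<n = ≤∧≢⇒< c<n (cliqueLike-short (r ∷ c) ((X ++ Y) ++ P) W↭′ cl′)
  ... | Z , T , Z++T , short , low =
    r ∷ Z , T , ↭-trans (shift r X Y) (prep r Z++T) ,
    subst (_< n) len-eq short , λ {t} t∈ →
      subst₂ (λ a b → a + b ≤ n) (deg-↭ G t (shift r Z c)) len-eq (low t∈)
    where
    len-eq : length (Z ++ r ∷ c) ≡ length ((r ∷ Z) ++ c)
    len-eq = ↭-length (shift r Z c)

  -- Minimum degree n/2: components and longest paths

  half-degree : List A → Set
  half-degree V = ∀ {u} → u ∈ V → n ≤ 2 * deg G u V

  SmallComponent : List A → Set
  SmallComponent V = ∃ λ C → ∃ λ R → V ↭ C ++ R × length C < n × 0 < length C ×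
    (∀ {u} → u ∈ C → deg G u R ≡ 0)

  -- If an end has a neighbour in `R`, the path gets longer. Otherwise the degrees of the ends
  -- within the path sum to at least n, and it closes to a cycle on the same vertices. Either a
  -- vertex of the cycle has a neighbour in `R`, and the cycle opened there yields a longer path, or
  -- its vertices are cut off from `R`. By `free` the path never reaches n vertices.
  grow-path : ∀ f V P x l R → W ↭ V ++ P → half-degree V →
    length R ≤ f → V ↭ (x ∷ l) ++ R → defects x l ≡ 0 → length (x ∷ l) < n →
    SmallComponent V
  lengthen : ∀ f V P x l R → W ↭ V ++ P → half-degree V →
    length R ≤ f → V ↭ (x ∷ l) ++ R → length (x ∷ l) < n →
    ∀ y m → y ∷ m ↭ x ∷ l → defects y m ≡ 0 → 0 < deg G y R →
    SmallComponent V

  lengthen f V P x l R W↭ half len V↭ short y m y∷m↭ path pos with deg-positive G y R pos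
  lengthen zero V P x l .(X ++ r ∷ Y) W↭ half len V↭ short y m y∷m↭ path pos
    | X , r , Y , refl , gyr with () ← subst (_≤ 0) (↭-length (shift r X Y)) len
  lengthen (suc f) V P x l .(X ++ r ∷ Y) W↭ half len V↭ short y m y∷m↭ path pos
    | X , r , Y , refl , gyr =
    grow-path f V P r (y ∷ m) (X ++ Y) W↭ half
      (s≤s⁻¹ (subst (_≤ suc f) (↭-length (shift r X Y)) len)) V↭′ path′
      (≤∧≢⇒< (subst (_< n) (sym (↭-length y∷m↭)) short)
        (free r (y ∷ m) ((X ++ Y) ++ P)
          (↭-trans W↭ (↭-trans (++⁺ʳ P V↭′) (↭-reflexive (++-assoc (r ∷ y ∷ m) (X ++ Y) P)))) path′))
    where
    V↭′ : V ↭ (r ∷ y ∷ m) ++ X ++ Y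
    V↭′ = ↭-trans V↭ (↭-trans (++⁺ʳ (X ++ r ∷ Y) (↭-sym y∷m↭))
            (↭-trans (++⁺ˡ (y ∷ m) (shift r X Y)) (shift r (y ∷ m) (X ++ Y))))
    path′ : defects r (y ∷ m) ≡ 0
    path′ = cong₂ _+_ (Defects.b-edge G (trans (G-sym r y) gyr)) path

  grow-path f V P x l R W↭ half len V↭ path short with deg G x R in dx | deg G (end x l) R in de
  ... | suc _ | _ =
    lengthen f V P x l R W↭ half len V↭ short x l ↭-refl path (subst (0 <_) (sym dx) z<s)
  ... | zero | suc _ =
    lengthen f V P x l R W↭ half len V↭ short (end x l) (back x l) (back-↭ x l)
      (trans (Defects.Symmetric.defects-back G G-sym x l) path) (subst (0 <_) (sym de) z<s)
  ... | zero | zero with Walk.Degree.crossing G G-irrefl x l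
          (≤-trans (<⇒≤ short) (n≤2a∧n≤2b⇒n≤a+b (deg G x (x ∷ l)) (deg G (end x l) (x ∷ l))
             (inner (here refl) dx) (inner (end-∈ x l) de)))
    where
    inner : ∀ {u} → u ∈ x ∷ l → deg G u R ≡ 0 → n ≤ 2 * deg G u (x ∷ l)
    inner {u} u∈ d0 = ≤-trans (half (∈-resp-↭ (↭-sym V↭) (∈-++⁺ˡ u∈)))
      (≤-reflexive (cong (2 *_) (trans (deg-↭ G u V↭)
        (trans (deg-++ G u (x ∷ l) R) (trans (cong (deg G u (x ∷ l) +_) d0) (+-identityʳ _))))))
  ...   | X , y , Y , refl , e₁ , e₂ = result
    where
    m = X ++ end y Y ∷ back y Y
    x∷m↭ : x ∷ m ↭ x ∷ X ++ y ∷ Y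
    x∷m↭ = two-opt-↭ x X y Y
    cyc : closed x m ≡ 0
    cyc = n≤0⇒n≡0 (≤-trans (Defects.Symmetric.closed-two-opt G G-sym x X y Y e₁ e₂) (≤-reflexive path))
    result : SmallComponent V
    result with search (λ u → does (0 <? deg G u R)) (x ∷ m)
    ... | inj₂ none = x ∷ m , R , ↭-trans V↭ (++⁺ʳ R (↭-sym x∷m↭)) ,
          subst (_< n) (sym (↭-length x∷m↭)) short , z<s ,
          λ u∈ → n≤0⇒n≡0 (≮⇒≥ (does⇒¬ (0 <? _) (none u∈)))
    ... | inj₁ (Z , u , Z′ , eq , pos)
      with Defects.rotate-to G x m (subst (u ∈_) (sym eq) (∈-++⁺ʳ Z (here refl)))
    ...   | k , u∷k↭ , cyc′ =
      lengthen f V P x (X ++ y ∷ Y) R W↭ half len V↭ short u k (↭-trans u∷k↭ x∷m↭)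
        (m+n≡0⇒m≡0 _ (trans cyc′ cyc)) (does⇒ (0 <? _) pos)

  -- Twice the number of edges inside l
  edges : List A → ℕ
  edges l = ∑ (λ u → deg G u l) l

  edges-↭ : ∀ {l m} → l ↭ m → edges l ≡ edges m
  edges-↭ {l} p = trans (∑-cong l (λ u → deg-↭ G u p)) (∑-↭ _ p)

  ∑-deg-sym : ∀ l m → ∑ (λ u → deg G u m) l ≡ ∑ (λ u → deg G u l) m
  ∑-deg-sym l m = trans (∑-swap (λ u v → ⟦ G u v ⟧) l m)
    (∑-cong m (λ v → ∑-cong l (λ u → cong ⟦_⟧ (G-sym u v))))

  edges-++ : ∀ l m → edges (l ++ m) ≡ edges l + edges m + 2 * ∑ (λ u → deg G u m) l
  edges-++ l m = begin
    edges (l ++ m)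
      ≡⟨ ∑-++ _ l m ⟩
    ∑ (λ u → deg G u (l ++ m)) l + ∑ (λ u → deg G u (l ++ m)) m
      ≡⟨ cong₂ _+_ (split l) (split m) ⟩
    (edges l + ∑ (λ u → deg G u m) l) + (∑ (λ u → deg G u l) m + edges m)
      ≡⟨ cong (λ t → (edges l + ∑ (λ u → deg G u m) l) + (t + edges m)) (∑-deg-sym m l) ⟩
    (edges l + ∑ (λ u → deg G u m) l) + (∑ (λ u → deg G u m) l + edges m)
      ≡⟨ arrange (edges l) (edges m) (∑ (λ u → deg G u m) l) ⟩
    edges l + edges m + 2 * ∑ (λ u → deg G u m) l ∎
    where
    open ≡-Reasoning
    split : ∀ k → ∑ (λ u → deg G u (l ++ m)) k ≡ ∑ (λ u → deg G u l) k + ∑ (λ u → deg G u m) k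
    split k = trans (∑-cong k (λ u → deg-++ G u l m)) (∑-+ _ _ k)
    arrange : ∀ a b c → (a + c) + (c + b) ≡ a + b + 2 * c
    arrange = solve-∀

  edges-∷ : ∀ u l → edges (u ∷ l) ≡ edges l + 2 * deg G u l
  edges-∷ u l = begin
    edges (u ∷ l)
      ≡⟨ edges-++ (u ∷ []) l ⟩
    ⟦ G u u ⟧ + 0 + 0 + edges l + 2 * (deg G u l + 0)
      ≡⟨ cong₂ (λ s t → ⟦ s ⟧ + 0 + 0 + edges l + 2 * t) (G-irrefl u) (+-identityʳ (deg G u l)) ⟩
    edges l + 2 * deg G u l ∎
    where open ≡-Reasoning

  edges≤square : ∀ l → edges l ≤ length l * length l
  edges≤square l = ≤-trans (∑-mono l (λ u → deg≤length G u l)) (≤-reflexive (∑-const (length l) l))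

  -- Peeling off low degrees, and absorbing into the cores

  IsCore : List A → Set
  IsCore c = length c < n × n ≤ 2 * length c × half-degree c

  cores : ∀ f V P → length V ≤ f → W ↭ V ++ P → half-degree V →
    ∃ λ cs → V ↭ concat cs × All IsCore cs × edges V ≤ ∑ edges cs
  cores f [] P len W↭ half = [] , ↭-refl , [] , z≤n
  cores (suc f) V@(v ∷ V′) P len W↭ half
    with grow-path (length V′) V P v [] V′ W↭ half ≤-refl ↭-refl refl 2≤n
  ... | C@(c ∷ C′) , R , V↭ , short , pos , sep
    with cores f R (C ++ P) (s≤s⁻¹ (≤-trans (≤-trans (s≤s (m≤n+m (length R) (length C′)))
            (≤-reflexive (trans (sym (length-++ C {R})) (sym (↭-length V↭))))) len))
          (↭-trans W↭ (↭-trans (++⁺ʳ P (↭-trans V↭ (++-comm C R))) (↭-reflexive (++-assoc R C P)))) halfR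
    where
    halfR : half-degree R
    halfR {u} u∈R = subst (λ t → n ≤ 2 * t) eq (half (∈-resp-↭ (↭-sym V↭) (∈-++⁺ʳ C u∈R)))
      where
      none : deg G u C ≡ 0
      none = n≤0⇒n≡0 (≤-trans (∑-member (λ w → deg G w C) u∈R)
               (≤-reflexive (trans (∑-deg-sym R C) (∑≡0 C sep))))
      eq : deg G u V ≡ deg G u R
      eq = trans (deg-↭ G u V↭) (trans (deg-++ G u C R) (cong (_+ deg G u R) none))
  ... | cs , R↭ , isC , e≤ =
    C ∷ cs , ↭-trans V↭ (++⁺ˡ C R↭) ,
    (short , ≤-trans (halfC (here refl)) (*-monoʳ-≤ 2 (deg≤length G c C)) , halfC) ∷ isC , bound
    where
    halfC : half-degree C
    halfC {u} u∈C = subst (λ t → n ≤ 2 * t)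
      (trans (deg-↭ G u V↭) (trans (deg-++ G u C R)
        (trans (cong (deg G u C +_) (sep u∈C)) (+-identityʳ _))))
      (half (∈-resp-↭ (↭-sym V↭) (∈-++⁺ˡ u∈C)))
    bound : edges V ≤ edges C + ∑ edges cs
    bound = begin
      edges V                                          ≡⟨ edges-↭ V↭ ⟩
      edges (C ++ R)                                   ≡⟨ edges-++ C R ⟩
      edges C + edges R + 2 * ∑ (λ u → deg G u R) C    ≡⟨ cong (λ t → edges C + edges R + 2 * t) (∑≡0 C sep) ⟩
      edges C + edges R + 0                            ≡⟨ +-identityʳ _ ⟩
      edges C + edges R                                ≤⟨ +-monoʳ-≤ (edges C) e≤ ⟩
      edges C + ∑ edges cs                             ∎
      where open ≤-Reasoning

  -- The list is in the order of deletion: each degree is taken into what was left at that moment.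
  Degenerate : List A → List A → Set
  Degenerate [] H = ⊤
  Degenerate (u ∷ o) H = 2 * deg G u (o ++ H) < n × Degenerate o H

  peel : ∀ f V P → length V ≤ f → W ↭ V ++ P →
    ∃ λ outs → ∃ λ cs → V ↭ outs ++ concat cs × All IsCore cs ×
    edges (concat cs) ≤ ∑ edges cs × Degenerate outs (concat cs)
  peel f V P len W↭ with search (λ u → does (2 * deg G u V <? n)) V
  ... | inj₂ none with cores (length V) V P ≤-refl W↭ (λ u∈ → ≮⇒≥ (does⇒¬ (_ <? n) (none u∈)))
  ...   | cs , V↭ , isC , e≤ = [] , cs , V↭ , isC , subst (_≤ _) (edges-↭ V↭) e≤ , tt
  peel zero .(X ++ u ∷ Y) P len W↭ | inj₁ (X , u , Y , refl , low)
    with () ← subst (_≤ 0) (↭-length (shift u X Y)) len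
  peel (suc f) .(X ++ u ∷ Y) P len W↭ | inj₁ (X , u , Y , refl , low)
    with peel f (X ++ Y) (u ∷ P) (s≤s⁻¹ (subst (_≤ suc f) (↭-length (shift u X Y)) len))
           (↭-trans W↭ (↭-trans (++⁺ʳ P (shift u X Y)) (↭-sym (shift u (X ++ Y) P))))
  ... | outs , cs , V↭ , isC , e≤ , dgn =
    u ∷ outs , cs , ↭-trans (shift u X Y) (prep u V↭) , isC , e≤ , low′ , dgn
    where
    low′ : 2 * deg G u (outs ++ concat cs) < n
    low′ = subst (λ t → 2 * t < n) degree-eq (does⇒ (_ <? n) low)
      where
      degree-eq : deg G u (X ++ u ∷ Y) ≡ deg G u (outs ++ concat cs)
      degree-eq = trans (deg-↭ G u (shift u X Y))
        (trans (cong (λ t → ⟦ t ⟧ + deg G u (X ++ Y)) (G-irrefl u)) (deg-↭ G u V↭))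

  -- `τ` is the room left over, the sum of n - size over the enlarged clusters. Every absorbed
  -- vertex takes up one unit of room, and a vertex of `T` has at most n - size neighbours in each
  -- cluster.
  absorb-all : ∀ cs R P → All IsCore cs → W ↭ concat cs ++ R ++ P →
    ∃ λ B → ∃ λ T → ∃ λ τ → R ↭ B ++ T ×
    τ + length B ≡ ∑ (λ c → n ∸ length c) cs ×
    (∀ {t} → t ∈ T → deg G t (concat cs ++ B) ≤ τ)
  absorb-all [] R P [] W↭ = [] , R , 0 , ↭-refl , refl , λ _ → z≤n
  absorb-all (c ∷ cs) R P ((short , _ , half) ∷ isC) W↭
    with absorb (length R) R c (concat cs ++ P) ≤-refl
           (↭-trans W↭ (↭-trans (↭-reflexive (++-assoc c (concat cs) (R ++ P))) (++⁺ˡ c (shifts (concat cs) R))))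
           (half-degree⇒cliqueLike c half) short
  ... | X , T₁ , R↭ , short′ , low
    with absorb-all cs T₁ (c ++ X ++ P) isC W↭′
    where
    W↭′ : W ↭ concat cs ++ T₁ ++ c ++ X ++ P
    W↭′ = ↭-trans W↭ (↭-trans (↭-reflexive (++-assoc c (concat cs) (R ++ P)))
      (↭-trans (shifts c (concat cs)) (++⁺ˡ (concat cs)
        (↭-trans (++⁺ˡ c (↭-trans (++⁺ʳ P (↭-trans R↭ (++-comm X T₁))) (↭-reflexive (++-assoc T₁ X P))))
          (shifts c T₁)))))
  ... | B , T , τ , T₁↭ , τ-eq , low′ =
    X ++ B , T , (n ∸ length (X ++ c)) + τ ,
    ↭-trans R↭ (↭-trans (++⁺ˡ X T₁↭) (↭-reflexive (sym (++-assoc X B T)))) ,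
    budget , degree
    where
    budget : (n ∸ length (X ++ c)) + τ + length (X ++ B) ≡ (n ∸ length c) + ∑ (λ c → n ∸ length c) cs
    budget = begin
      (n ∸ length (X ++ c)) + τ + length (X ++ B)
        ≡⟨ cong ((n ∸ length (X ++ c)) + τ +_) (length-++ X) ⟩
      (n ∸ length (X ++ c)) + τ + (length X + length B)
        ≡⟨ +-interchange (n ∸ length (X ++ c)) τ (length X) (length B) ⟩
      ((n ∸ length (X ++ c)) + length X) + (τ + length B)
        ≡⟨ cong₂ _+_ first τ-eq ⟩
      (n ∸ length c) + ∑ (λ c → n ∸ length c) cs ∎
      where
      open ≡-Reasoning
      Xc≤n : length X + length c ≤ n
      Xc≤n = ≤-trans (≤-reflexive (sym (length-++ X))) (<⇒≤ short′)
      first : (n ∸ length (X ++ c)) + length X ≡ n ∸ length c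
      first = trans (cong (λ t → n ∸ t + length X) (trans (length-++ X) (+-comm (length X) _)))
        (trans (cong (_+ length X) (sym (∸-+-assoc n (length c) (length X))))
          (m∸n+n≡m (m+n≤o⇒m≤o∸n (length X) Xc≤n)))
    degree : ∀ {t} → t ∈ T → deg G t ((c ++ concat cs) ++ X ++ B) ≤ (n ∸ length (X ++ c)) + τ
    degree {t} t∈ = begin
      deg G t ((c ++ concat cs) ++ X ++ B)
        ≡⟨ deg-↭ G t (↭-trans (↭-reflexive (++-assoc c (concat cs) (X ++ B))) (↭-trans (++⁺ˡ c (shifts (concat cs) X))
             (↭-trans (shifts c X) (↭-reflexive (sym (++-assoc X c _)))))) ⟩
      deg G t ((X ++ c) ++ concat cs ++ B)
        ≡⟨ deg-++ G t (X ++ c) _ ⟩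
      deg G t (X ++ c) + deg G t (concat cs ++ B)
        ≤⟨ +-mono-≤ (m+n≤o⇒m≤o∸n _ (low (∈-resp-↭ (↭-sym T₁↭) (∈-++⁺ʳ B t∈)))) (low′ t∈) ⟩
      (n ∸ length (X ++ c)) + τ ∎
      where open ≤-Reasoning

  -- The shortfall caused by the leftover vertices

  gain : ℕ → ℕ → ℕ
  gain τ zero = 0
  gain τ (suc t) = gain τ t + (n ∸ 2 * (τ + t))

  -- Telescoping with y² ≤ 4y + (y - 2)², which also survives truncated subtraction at y = 0 and y =
  -- 1.
  gain-bound : ∀ τ t → (n ∸ 2 * τ) * (n ∸ 2 * τ) ≤
    4 * gain τ t + (n ∸ 2 * (τ + t)) * (n ∸ 2 * (τ + t))
  gain-bound τ zero =
    ≤-reflexive (cong (λ k → (n ∸ 2 * k) * (n ∸ 2 * k)) (sym (+-identityʳ τ)))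
  gain-bound τ (suc t) = begin
    (n ∸ 2 * τ) * (n ∸ 2 * τ)                   ≤⟨ gain-bound τ t ⟩
    4 * gain τ t + y * y                        ≤⟨ +-monoʳ-≤ (4 * gain τ t) (step y) ⟩
    4 * gain τ t + (4 * y + (y ∸ 2) * (y ∸ 2))  ≡⟨ arrange (gain τ t) y ((y ∸ 2) * (y ∸ 2)) ⟩
    4 * (gain τ t + y) + (y ∸ 2) * (y ∸ 2)      ≡⟨ cong (λ z → 4 * (gain τ t + y) + z * z) next ⟩
    4 * (gain τ t + y) + (n ∸ 2 * (τ + suc t)) * (n ∸ 2 * (τ + suc t)) ∎
    where
    open ≤-Reasoning
    y = n ∸ 2 * (τ + t)
    arrange : ∀ a b c → 4 * a + (4 * b + c) ≡ 4 * (a + b) + c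
    arrange = solve-∀
    step : ∀ y → y * y ≤ 4 * y + (y ∸ 2) * (y ∸ 2)
    step zero = z≤n
    step (suc zero) = s≤s z≤n
    step (suc (suc z)) = ≤-trans (m≤m+n _ 4) (≤-reflexive (expand z))
      where
      expand : ∀ z → (2 + z) * (2 + z) + 4 ≡ 4 * (2 + z) + z * z
      expand = solve-∀
    next : y ∸ 2 ≡ n ∸ 2 * (τ + suc t)
    next = trans (∸-+-assoc n (2 * (τ + t)) 2) (cong (n ∸_) (double τ t))
      where
      double : ∀ τ t → 2 * (τ + t) + 2 ≡ 2 * (τ + suc t)
      double = solve-∀

  module _ (T B H : List A) (τ : ℕ) (W↭T++B : W ↭ T ++ B)
           (low : ∀ {t} → t ∈ T → deg G t B ≤ τ)
           (H-avoids-T : ∀ {v} → v ∈ H → ¬ v ∈ T) where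

    marked : A → ℕ
    marked v = ⟦ does (v ∈? T) ⟧

    -- Neighbours outside `T` lie in `B`, where `low` allows only τ of them; neighbours in `T` must
    -- lie in `o`, because `H` avoids `T`.
    marked-degree : ∀ {u} o P → W ↭ P ++ (o ++ H) → u ∈ T → deg G u (o ++ H) ≤ τ + ∑ marked o
    marked-degree {u} o P W↭ u∈T = begin
      deg G u (o ++ H)
        ≤⟨ ∑-mono (o ++ H) pointwise ⟩
      ∑ (λ v → unmarked v + marked v) (o ++ H)
        ≡⟨ ∑-+ unmarked marked (o ++ H) ⟩
      ∑ unmarked (o ++ H) + ∑ marked (o ++ H)
        ≤⟨ +-mono-≤ outside (≤-reflexive inside) ⟩
      τ + ∑ marked o ∎
      where
      open ≤-Reasoning
      unmarked : A → ℕ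
      unmarked v = ⟦ not (does (v ∈? T)) ∧ G u v ⟧
      pointwise : ∀ v → ⟦ G u v ⟧ ≤ unmarked v + marked v
      pointwise v with does (v ∈? T)
      ... | true = ⟦⟧≤1 (G u v)
      ... | false = ≤-reflexive (sym (+-identityʳ _))
      inside : ∑ marked (o ++ H) ≡ ∑ marked o
      inside = trans (∑-++ marked o H) (trans (cong (∑ marked o +_)
        (∑≡0 H (λ {v} v∈ → cong ⟦_⟧ (dec-false (v ∈? T) (H-avoids-T v∈))))) (+-identityʳ _))
      unmarked≤ : ∀ v → unmarked v ≤ ⟦ G u v ⟧
      unmarked≤ v with does (v ∈? T)
      ... | true = z≤n
      ... | false = ≤-refl
      outside : ∑ unmarked (o ++ H) ≤ τ
      outside = begin
        ∑ unmarked (o ++ H)                ≤⟨ m≤n+m _ (∑ unmarked P) ⟩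
        ∑ unmarked P + ∑ unmarked (o ++ H) ≡⟨ ∑-++ unmarked P (o ++ H) ⟨
        ∑ unmarked (P ++ (o ++ H))         ≡⟨ ∑-↭ unmarked (↭-trans (↭-sym W↭) W↭T++B) ⟩
        ∑ unmarked (T ++ B)                ≡⟨ ∑-++ unmarked T B ⟩
        ∑ unmarked T + ∑ unmarked B        ≡⟨ cong (_+ ∑ unmarked B) (∑≡0 T (λ {v} v∈ →
                                                cong (λ t → ⟦ not t ∧ G u v ⟧) (dec-true (v ∈? T) v∈))) ⟩
        ∑ unmarked B                       ≤⟨ ∑-mono B unmarked≤ ⟩
        deg G u B                          ≤⟨ low u∈T ⟩
        τ                                  ∎

    -- Put the deleted vertices back, the last one first. Each `u` brings 2d < n ordered pairs. If
    -- `u` is in `T` and t members of `T` were deleted after it, then also d ≤ τ + t, so it falls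
    -- short of n by at least n - 2(τ + t).
    edges-gain : ∀ o P → W ↭ P ++ (o ++ H) → Degenerate o H →
      edges (o ++ H) + gain τ (∑ marked o) ≤ edges H + n * length o
    edges-gain [] P W↭ _ = ≤-reflexive (cong (edges H +_) (sym (*-zeroʳ n)))
    edges-gain (u ∷ o) P W↭ (low-u , dgn) = begin
      edges (u ∷ o ++ H) + gain τ (marked u + ∑ marked o)
        ≡⟨ cong (_+ gain τ (marked u + ∑ marked o)) (edges-∷ u (o ++ H)) ⟩
      edges (o ++ H) + 2 * d + gain τ (marked u + ∑ marked o)
        ≤⟨ step ⟩
      edges (o ++ H) + gain τ (∑ marked o) + n
        ≤⟨ +-monoˡ-≤ n (edges-gain o (P ++ u ∷ []) W↭′ dgn) ⟩
      edges H + n * length o + n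
        ≡⟨ arrange (edges H) n (length o) ⟩
      edges H + n * suc (length o) ∎
      where
      open ≤-Reasoning
      d = deg G u (o ++ H)
      W↭′ : W ↭ (P ++ u ∷ []) ++ (o ++ H)
      W↭′ = ↭-trans W↭ (↭-reflexive (sym (++-assoc P (u ∷ []) (o ++ H))))
      arrange : ∀ e n l → e + n * l + n ≡ e + n * suc l
      arrange = solve-∀
      fits : ∀ t → d ≤ τ + t → 2 * d + (n ∸ 2 * (τ + t)) ≤ n
      fits t d≤ with ≤-total (2 * (τ + t)) n
      ... | inj₁ p = ≤-trans (+-monoˡ-≤ _ (*-monoʳ-≤ 2 d≤)) (≤-reflexive (m+[n∸m]≡n p))
      -- Here the subtraction is cut off at 0, and the deletion rule 2d < n is enough.
      ... | inj₂ p rewrite m≤n⇒m∸n≡0 p = ≤-trans (≤-reflexive (+-identityʳ _)) (<⇒≤ low-u)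
      step : edges (o ++ H) + 2 * d + gain τ (marked u + ∑ marked o) ≤
             edges (o ++ H) + gain τ (∑ marked o) + n
      step with u ∈? T
      ... | no _ = ≤-trans (+-monoˡ-≤ _ (+-monoʳ-≤ (edges (o ++ H)) (<⇒≤ low-u)))
                     (≤-reflexive (+-swap-last (edges (o ++ H)) n _))
      ... | yes u∈T = ≤-trans
        (≤-reflexive (+-interchange (edges (o ++ H)) (2 * d) (gain τ (∑ marked o)) (n ∸ 2 * (τ + ∑ marked o))))
        (+-monoʳ-≤ (edges (o ++ H) + gain τ (∑ marked o))
          (fits (∑ marked o) (marked-degree o (P ++ u ∷ []) W↭′ u∈T)))

  -- The shortfall within the cores

  private
    σ : List A → ℕ
    σ c = n ∸ length c

    -- What even a complete core lacks: |c|² = n |c| - |c| (n - |c|).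
    sσ : List A → ℕ
    sσ c = length c * σ c

  core-σ : ∀ {c} → IsCore c → length c + σ c ≡ n
  core-σ (short , _) = m+[n∸m]≡n (<⇒≤ short)

  cores-length : ∀ {cs} → All IsCore cs → length (concat cs) + ∑ σ cs ≡ n * length cs
  cores-length [] = sym (*-zeroʳ n)
  cores-length {c ∷ cs} (isC ∷ isCs) = begin
    length (c ++ concat cs) + (σ c + ∑ σ cs)            ≡⟨ cong (_+ (σ c + ∑ σ cs)) (length-++ c) ⟩
    length c + length (concat cs) + (σ c + ∑ σ cs)      ≡⟨ +-interchange (length c) (length (concat cs)) (σ c) (∑ σ cs) ⟩
    (length c + σ c) + (length (concat cs) + ∑ σ cs)    ≡⟨ cong₂ _+_ (core-σ isC) (cores-length isCs) ⟩
    n + n * length cs                                   ≡⟨ *-suc n (length cs) ⟨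
    n * length (c ∷ cs)                                 ∎
    where
    open ≡-Reasoning

  cores-edges : ∀ {cs} → All IsCore cs → ∑ edges cs + ∑ sσ cs ≤ n * length (concat cs)
  cores-edges [] = z≤n
  cores-edges {c ∷ cs} (isC ∷ isCs) = begin
    edges c + ∑ edges cs + (sσ c + ∑ sσ cs)    ≡⟨ +-interchange (edges c) (∑ edges cs) (sσ c) (∑ sσ cs) ⟩
    (edges c + sσ c) + (∑ edges cs + ∑ sσ cs)  ≤⟨ +-mono-≤ one (cores-edges isCs) ⟩
    n * length c + n * length (concat cs)      ≡⟨ *-distribˡ-+ n (length c) _ ⟨
    n * (length c + length (concat cs))        ≡⟨ cong (n *_) (length-++ c) ⟨
    n * length (c ++ concat cs)                ∎
    where
    open ≤-Reasoning
    one : edges c + sσ c ≤ n * length c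
    one = begin
      edges c + length c * σ c             ≤⟨ +-monoˡ-≤ _ (edges≤square c) ⟩
      length c * length c + length c * σ c ≡⟨ *-distribˡ-+ (length c) (length c) (σ c) ⟨
      length c * (length c + σ c)          ≡⟨ cong (length c *_) (core-σ isC) ⟩
      length c * n                         ≡⟨ *-comm (length c) n ⟩
      n * length c                         ∎

  n∑σ≤2∑sσ : ∀ {cs} → All IsCore cs → n * ∑ σ cs ≤ 2 * ∑ sσ cs
  n∑σ≤2∑sσ [] = ≤-reflexive (*-zeroʳ n)
  n∑σ≤2∑sσ {c ∷ cs} ((_ , n≤2s , _) ∷ isCs) = begin
    n * (σ c + ∑ σ cs)            ≡⟨ *-distribˡ-+ n (σ c) _ ⟩
    n * σ c + n * ∑ σ cs          ≤⟨ +-mono-≤ (*-monoˡ-≤ (σ c) n≤2s) (n∑σ≤2∑sσ isCs) ⟩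
    2 * length c * σ c + 2 * ∑ sσ cs ≡⟨ arrange (length c) (σ c) (∑ sσ cs) ⟩
    2 * (sσ c + ∑ sσ cs)          ∎
    where
    open ≤-Reasoning
    arrange : ∀ a b c → 2 * a * b + 2 * c ≡ 2 * (a * b + c)
    arrange = solve-∀

  -- The σ of one core is at most the sum of all, so every core has at least n - z vertices.
  n∑σ≤∑sσ+z∑σ : ∀ {cs z} → All IsCore cs → ∑ σ cs ≤ z → n * ∑ σ cs ≤ ∑ sσ cs + z * ∑ σ cs
  n∑σ≤∑sσ+z∑σ {z = z} [] _ = ≤-trans (≤-reflexive (*-zeroʳ n)) z≤n
  n∑σ≤∑sσ+z∑σ {c ∷ cs} {z} (isC ∷ isCs) h = begin
    n * (σ c + ∑ σ cs)
      ≡⟨ *-distribˡ-+ n (σ c) _ ⟩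
    n * σ c + n * ∑ σ cs
      ≡⟨ cong (λ t → t * σ c + n * ∑ σ cs) (core-σ isC) ⟨
    (length c + σ c) * σ c + n * ∑ σ cs
      ≤⟨ +-mono-≤ (*-monoˡ-≤ (σ c) (+-monoʳ-≤ (length c) (≤-trans (m≤m+n _ _) h)))
           (n∑σ≤∑sσ+z∑σ isCs (≤-trans (m≤n+m _ (σ c)) h)) ⟩
    (length c + z) * σ c + (∑ sσ cs + z * ∑ σ cs)
      ≡⟨ arrange (length c) z (σ c) (∑ sσ cs) (∑ σ cs) ⟩
    sσ c + ∑ sσ cs + z * (σ c + ∑ σ cs) ∎
    where
    open ≤-Reasoning
    arrange : ∀ s z a p q → (s + z) * a + (p + z * q) ≡ s * a + p + z * (a + q)
    arrange = solve-∀

  -- The dichotomy for one colour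

  Sparse : Set
  Sparse = 4 * edges W + n * n ≤ 4 * (n * length W)

  record Clustered : Set where
    field
      outs : List A
      clusters : List (List A)
      partition : W ↭ outs ++ concat clusters
      outs-few : length outs ≤ n
      clusters-small : All (λ c → length c ≤ n) clusters
      clusters-few : 2 * (n * length clusters) ≤ 2 * length W + n
      edges-bound : edges W ≤ ∑ edges clusters + n * length outs

  -- Let Z be the sum of n - |c| over the cores. If Z ≥ n/2, the cores alone lack n²/4, having at
  -- least n/2 vertices each. If Z ≤ n/2 and |T| ≥ n/2, the cores lack (n - Z) Z and the leftover
  -- vertices (n - 2Z)²/4, which add up to exactly n²/4. Otherwise at most Z ≤ n/2 vertices were
  -- absorbed and at most n/2 are left over, so `outs` has at most n.
  sparse⊎clustered : Sparse ⊎ Clustered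
  sparse⊎clustered
    with peel (length W) W [] ≤-refl (↭-reflexive (sym (++-identityʳ W)))
  ... | outs , cs , W↭ , isCs , eH , dgn
    with absorb-all cs outs [] isCs
           (↭-trans W↭ (↭-trans (++-comm outs (concat cs)) (++⁺ˡ (concat cs) (↭-reflexive (sym (++-identityʳ outs))))))
  ... | B , T , τ , outs↭ , budget , low = decide
    where
    open ≤-Reasoning
    H = concat cs
    s = ∑ sσ cs
    Z = ∑ σ cs
    W↭T++ : W ↭ T ++ (H ++ B)
    W↭T++ = ↭-trans W↭ (↭-trans (++⁺ʳ H (↭-trans outs↭ (++-comm B T)))
      (↭-trans (↭-reflexive (++-assoc T B H)) (++⁺ˡ T (++-comm B H))))
    H-avoids-T : ∀ {v} → v ∈ H → ¬ v ∈ T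
    H-avoids-T {v} v∈H v∈T = <⇒≱ (+-mono-≤ (∈⇒1≤mult v∈T) (∈⇒1≤mult v∈HB))
      (subst (_≤ 1) (trans (∑-↭ (δ v) W↭T++) (∑-++ (δ v) T (H ++ B))) (W-distinct v))
      where
      v∈HB : v ∈ H ++ B
      v∈HB = ∈-++⁺ˡ v∈H
    m : A → ℕ
    m v = ⟦ does (v ∈? T) ⟧
    t = ∑ m outs
    T≤t : length T ≤ t
    T≤t = begin
      length T        ≡⟨ ∑-one T ⟨
      ∑ (λ _ → 1) T   ≤⟨ ∑-mono-∈ T (λ {v} v∈ → ≤-reflexive (sym (cong ⟦_⟧ (dec-true (v ∈? T) v∈)))) ⟩
      ∑ m T           ≤⟨ m≤n+m _ (∑ m B) ⟩
      ∑ m B + ∑ m T   ≡⟨ ∑-++ m B T ⟨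
      ∑ m (B ++ T)    ≡⟨ ∑-↭ m outs↭ ⟨
      ∑ m outs        ∎
    eW : edges W + gain τ t ≤ edges H + n * length outs
    eW = ≤-trans (≤-reflexive (cong (_+ gain τ t) (edges-↭ W↭)))
      (edges-gain T (H ++ B) H τ W↭T++ low H-avoids-T outs [] W↭ dgn)
    lengths : length outs + length H ≡ length W
    lengths = trans (sym (length-++ outs)) (sym (↭-length W↭))
    total : edges W + gain τ t + s ≤ n * length W
    total = begin
      edges W + gain τ t + s               ≤⟨ +-monoˡ-≤ s eW ⟩
      edges H + n * length outs + s        ≤⟨ +-monoˡ-≤ s (+-monoˡ-≤ _ eH) ⟩
      ∑ edges cs + n * length outs + s     ≡⟨ +-swap-last (∑ edges cs) (n * length outs) s ⟩
      ∑ edges cs + s + n * length outs     ≤⟨ +-monoˡ-≤ _ (cores-edges isCs) ⟩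
      n * length H + n * length outs       ≡⟨ *-distribˡ-+ n (length H) _ ⟨
      n * (length H + length outs)         ≡⟨ cong (n *_) (trans (+-comm (length H) _) lengths) ⟩
      n * length W                         ∎
    sparse : n * n ≤ 4 * (gain τ t + s) → Sparse
    sparse h = begin
      4 * edges W + n * n                    ≤⟨ +-monoʳ-≤ _ h ⟩
      4 * edges W + 4 * (gain τ t + s)       ≡⟨ arrange (edges W) (gain τ t) s ⟩
      4 * (edges W + gain τ t + s)           ≤⟨ *-monoʳ-≤ 4 total ⟩
      4 * (n * length W)                     ∎
      where
      arrange : ∀ a b c → 4 * a + 4 * (b + c) ≡ 4 * (a + b + c)
      arrange = solve-∀
    τ≤Z : τ ≤ Z
    τ≤Z = ≤-trans (m≤m+n τ (length B)) (≤-reflexive budget)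
    many-σ : n ≤ 2 * Z → Sparse
    many-σ h = sparse (begin
      n * n                ≤⟨ *-monoʳ-≤ n h ⟩
      n * (2 * Z)          ≡⟨ move n Z ⟩
      2 * (n * Z)          ≤⟨ *-monoʳ-≤ 2 (n∑σ≤2∑sσ isCs) ⟩
      2 * (2 * s)          ≡⟨ quad s ⟩
      4 * s                ≤⟨ *-monoʳ-≤ 4 (m≤n+m s (gain τ t)) ⟩
      4 * (gain τ t + s)   ∎)
      where
      move : ∀ a b → a * (2 * b) ≡ 2 * (a * b)
      move = solve-∀
      quad : ∀ a → 2 * (2 * a) ≡ 4 * a
      quad = solve-∀
    -- 4 ∑ s σ + (n − 2 ∑ σ)² ≥ n², with n = 2 ∑ σ + d
    many-T : 2 * Z ≤ n → n ≤ 2 * length T → Sparse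
    many-T h h′ = sparse (+-cancelʳ-≤ (4 * (Z * Z)) (n * n) (4 * (gain τ t + s)) (begin
      n * n + 4 * (Z * Z)                     ≡⟨ cong (λ k → k * k + 4 * (Z * Z)) n≡ ⟩
      (2 * Z + d) * (2 * Z + d) + 4 * (Z * Z) ≡⟨ expand Z d ⟩
      d * d + 4 * ((2 * Z + d) * Z)           ≡⟨ cong (λ k → d * d + 4 * (k * Z)) n≡ ⟨
      d * d + 4 * (n * Z)                     ≤⟨ +-mono-≤ d²≤ (*-monoʳ-≤ 4 (n∑σ≤∑sσ+z∑σ isCs ≤-refl)) ⟩
      4 * gain τ t + 4 * (s + Z * Z)          ≡⟨ arrange (gain τ t) s (Z * Z) ⟩
      4 * (gain τ t + s) + 4 * (Z * Z)        ∎))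
      where
      d = n ∸ 2 * Z
      n≡ : n ≡ 2 * Z + d
      n≡ = sym (m+[n∸m]≡n h)
      expand : ∀ z d → (2 * z + d) * (2 * z + d) + 4 * (z * z) ≡ d * d + 4 * ((2 * z + d) * z)
      expand = solve-∀
      arrange : ∀ a b c → 4 * a + 4 * (b + c) ≡ 4 * (a + b) + 4 * c
      arrange = solve-∀
      exhausted : n ∸ 2 * (τ + t) ≡ 0
      exhausted = m≤n⇒m∸n≡0 (≤-trans h′ (*-monoʳ-≤ 2 (≤-trans T≤t (m≤n+m t τ))))
      d≤ : d ≤ n ∸ 2 * τ
      d≤ = ∸-monoʳ-≤ n (*-monoʳ-≤ 2 τ≤Z)
      d²≤ : d * d ≤ 4 * gain τ t
      d²≤ = begin
        d * d                                                         ≤⟨ *-mono-≤ d≤ d≤ ⟩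
        (n ∸ 2 * τ) * (n ∸ 2 * τ)                                     ≤⟨ gain-bound τ t ⟩
        4 * gain τ t + (n ∸ 2 * (τ + t)) * (n ∸ 2 * (τ + t))          ≡⟨ cong (λ k → 4 * gain τ t + k * k) exhausted ⟩
        4 * gain τ t + 0                                              ≡⟨ +-identityʳ _ ⟩
        4 * gain τ t                                                  ∎
    few : 2 * Z ≤ n → 2 * length T ≤ n → Clustered
    few h h′ = record
      { outs = outs
      ; clusters = cs
      ; partition = W↭
      ; outs-few = *-cancelˡ-≤ 2 (begin
          2 * length outs                 ≡⟨ cong (2 *_) (trans (↭-length outs↭) (length-++ B)) ⟩
          2 * (length B + length T)       ≡⟨ *-distribˡ-+ 2 (length B) _ ⟩
          2 * length B + 2 * length T     ≤⟨ +-mono-≤ (≤-trans (*-monoʳ-≤ 2 (≤-trans (m≤n+m _ τ) (≤-reflexive budget))) h) h′ ⟩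
          n + n                           ≡⟨ cong (n +_) (+-identityʳ n) ⟨
          2 * n                           ∎)
      ; clusters-small = All-map (λ c → <⇒≤ (proj₁ c)) isCs
      ; clusters-few = begin
          2 * (n * length cs)             ≡⟨ cong (2 *_) (cores-length isCs) ⟨
          2 * (length H + Z)              ≡⟨ *-distribˡ-+ 2 (length H) Z ⟩
          2 * length H + 2 * Z            ≤⟨ +-mono-≤ (*-monoʳ-≤ 2 (≤-trans (m≤n+m _ (length outs)) (≤-reflexive lengths))) h ⟩
          2 * length W + n                ∎
      ; edges-bound = ≤-trans (m≤m+n _ _) (≤-trans eW (+-monoˡ-≤ _ eH))
      }
    decide : Sparse ⊎ Clustered
    decide with ≤-total n (2 * Z) | ≤-total n (2 * length T)
    ... | inj₁ p | _ = inj₁ (many-σ p)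
    ... | inj₂ p | inj₁ q = inj₁ (many-T p q)
    ... | inj₂ p | inj₂ q = inj₂ (few p q)

-- Overlap of two cluster families

∑² : ∀ {A : Set} → (A → A → ℕ) → List A → ℕ
∑² f l = ∑ (λ u → ∑ (f u) l) l

∑²-+ : ∀ {A : Set} (f g : A → A → ℕ) l → ∑² (λ u v → f u v + g u v) l ≡ ∑² f l + ∑² g l
∑²-+ f g l = trans (∑-cong l (λ u → ∑-+ (f u) (g u) l)) (∑-+ _ _ l)

∑²-mono : ∀ {A : Set} {f g : A → A → ℕ} l → (∀ u v → f u v ≤ g u v) → ∑² f l ≤ ∑² g l
∑²-mono l h = ∑-mono l (λ u → ∑-mono l (h u))

∑²-∑ : ∀ {A B : Set} (f : B → A → A → ℕ) (bs : List B) l →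
  ∑ (λ i → ∑² (f i) l) bs ≡ ∑² (λ u v → ∑ (λ i → f i u v) bs) l
∑²-∑ f bs l = trans (∑-swap (λ i u → ∑ (f i u) l) bs l)
  (∑-cong l (λ u → ∑-swap (λ i v → f i u v) bs l))

∑²-product : ∀ {A : Set} (f g : A → ℕ) l → ∑² (λ u v → f u * g v) l ≡ ∑ f l * ∑ g l
∑²-product f g l = trans (∑-cong l (λ u → ∑-*ˡ (f u) g l)) (∑-*ʳ (∑ g l) f l)

module Overlap {A : Set} (_≟_ : DecidableEquality A) (V : List A)
  (V-once : ∀ u → Multiplicity.mult _≟_ u V ≡ 1) where

  open Multiplicity _≟_

  δ-sym-* : ∀ (f : A → ℕ) u x → δ u x * f u ≡ δ x u * f x
  δ-sym-* f u x with u ≟ x | x ≟ u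
  ... | yes refl | yes _ = refl
  ... | yes u≡x | no x≢u = ⊥-elim (x≢u (sym u≡x))
  ... | no u≢x | yes x≡u = ⊥-elim (u≢x (sym x≡u))
  ... | no _ | no _ = refl

  -- Turns a sum over one part into a weighted sum over `V`, so that different partitions can be
  -- compared pair by pair.
  ∑-mult : ∀ f l → ∑ f l ≡ ∑ (λ u → mult u l * f u) V
  ∑-mult f [] = sym (∑≡0 V (λ _ → refl))
  ∑-mult f (x ∷ l) = sym (begin
    ∑ (λ u → (δ u x + mult u l) * f u) V
      ≡⟨ ∑-cong V (λ u → *-distribʳ-+ (f u) (δ u x) (mult u l)) ⟩
    ∑ (λ u → δ u x * f u + mult u l * f u) V
      ≡⟨ ∑-+ _ _ V ⟩
    ∑ (λ u → δ u x * f u) V + ∑ (λ u → mult u l * f u) V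
      ≡⟨ cong₂ _+_ (trans (∑-cong V (λ u → δ-sym-* f u x)) (∑-*ʳ (f x) (δ x) V)) (sym (∑-mult f l)) ⟩
    mult x V * f x + ∑ f l
      ≡⟨ cong (λ t → t * f x + ∑ f l) (V-once x) ⟩
    1 * f x + ∑ f l
      ≡⟨ cong (_+ ∑ f l) (*-identityˡ (f x)) ⟩
    f x + ∑ f l ∎)
    where open ≡-Reasoning

  length-mult : ∀ l → ∑ (λ u → mult u l) V ≡ length l
  length-mult l = trans (∑-cong V (λ u → sym (*-identityʳ _))) (trans (sym (∑-mult (λ _ → 1) l)) (∑-one l))

  -- together cs u v = 1 when u and v lie in a common member of the disjoint family cs
  together : List (List A) → A → A → ℕ
  together cs u v = ∑ (λ c → mult u c * mult v c) cs

  ∑²-together : ∀ cs l → ∑² (together cs) l ≡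
    ∑ (λ c → ∑ (λ u → mult u c) l * ∑ (λ u → mult u c) l) cs
  ∑²-together cs l = trans (sym (∑²-∑ (λ c u v → mult u c * mult v c) cs l))
    (∑-cong cs (λ c → ∑²-product (λ u → mult u c) (λ v → mult v c) l))

  ∑²-mult : ∀ f c → ∑² f c ≡ ∑² (λ u v → f u v * (mult u c * mult v c)) V
  ∑²-mult f c = begin
    ∑ (λ u → ∑ (f u) c) c
      ≡⟨ ∑-mult _ c ⟩
    ∑ (λ u → mult u c * ∑ (f u) c) V
      ≡⟨ ∑-cong V (λ u → trans (cong (mult u c *_) (∑-mult (f u) c)) (sym (∑-*ˡ (mult u c) _ V))) ⟩
    ∑ (λ u → ∑ (λ v → mult u c * (mult v c * f u v)) V) V
      ≡⟨ ∑-cong V (λ u → ∑-cong V (λ v → arrange (mult u c) (mult v c) (f u v))) ⟩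
    ∑² (λ u v → f u v * (mult u c * mult v c)) V ∎
    where
    open ≡-Reasoning
    arrange : ∀ a b c → a * (b * c) ≡ c * (a * b)
    arrange = solve-∀

  ∑-clusters : ∀ f cs → ∑ (∑² f) cs ≡ ∑² (λ u v → f u v * together cs u v) V
  ∑-clusters f cs = begin
    ∑ (∑² f) cs
      ≡⟨ ∑-cong cs (∑²-mult f) ⟩
    ∑ (λ c → ∑² (λ u v → f u v * (mult u c * mult v c)) V) cs
      ≡⟨ ∑²-∑ (λ c u v → f u v * (mult u c * mult v c)) cs V ⟩
    ∑² (λ u v → ∑ (λ c → f u v * (mult u c * mult v c)) cs) V
      ≡⟨ ∑-cong V (λ u → ∑-cong V (λ v → ∑-*ˡ (f u v) _ cs)) ⟩
    ∑² (λ u v → f u v * together cs u v) V ∎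
    where open ≡-Reasoning

  module Partition (outs : List A) (cs : List (List A)) (V↭ : V ↭ outs ++ concat cs) where

    mult-partition : ∀ u → mult u outs + ∑ (mult u) cs ≡ 1
    mult-partition u = begin
      mult u outs + ∑ (mult u) cs         ≡⟨ cong (mult u outs +_) (∑-concat (δ u) cs) ⟨
      mult u outs + mult u (concat cs)    ≡⟨ ∑-++ (δ u) outs (concat cs) ⟨
      mult u (outs ++ concat cs)          ≡⟨ ∑-↭ (δ u) V↭ ⟨
      mult u V                            ≡⟨ V-once u ⟩
      1                                   ∎
      where open ≡-Reasoning

    ∑-mult≤1 : ∀ u → ∑ (mult u) cs ≤ 1
    ∑-mult≤1 u = ≤-trans (m≤n+m _ _) (≤-reflexive (mult-partition u))

    together≤1 : ∀ u v → together cs u v ≤ 1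
    together≤1 u v = begin
      ∑ (λ c → mult u c * mult v c) cs ≤⟨ ∑-mono-∈ cs (λ {c} c∈ → ≤-trans (*-monoʳ-≤ (mult u c)
                                             (≤-trans (∑-member (mult v) c∈) (∑-mult≤1 v))) (≤-reflexive (*-identityʳ _))) ⟩
      ∑ (mult u) cs                    ≤⟨ ∑-mult≤1 u ⟩
      1                                ∎
      where open ≤-Reasoning

    ∑-clusters≤ : ∀ f → ∑ (∑² f) cs ≤ ∑² f V
    ∑-clusters≤ f = begin
      ∑ (∑² f) cs                            ≡⟨ ∑-clusters f cs ⟩
      ∑² (λ u v → f u v * together cs u v) V ≤⟨ ∑²-mono V (λ u v → ≤-trans (*-monoʳ-≤ (f u v) (together≤1 u v)) (≤-reflexive (*-identityʳ _))) ⟩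
      ∑² f V                                 ∎
      where open ≤-Reasoning

    length-partition : length outs + ∑ length cs ≡ length V
    length-partition = begin
      length outs + ∑ length cs             ≡⟨ cong (length outs +_) (∑-cong cs (λ c → sym (∑-one c))) ⟩
      length outs + ∑ (∑ (λ _ → 1)) cs      ≡⟨ cong (length outs +_) (∑-concat (λ _ → 1) cs) ⟨
      length outs + ∑ (λ _ → 1) (concat cs) ≡⟨ cong (length outs +_) (∑-one (concat cs)) ⟩
      length outs + length (concat cs)      ≡⟨ length-++ outs ⟨
      length (outs ++ concat cs)            ≡⟨ ↭-length V↭ ⟨
      length V                              ∎
      where open ≡-Reasoning

    squares≤ : ∀ {n} → All (λ c → length c ≤ n) cs → ∑ (λ c → length c * length c) cs ≤ n * ∑ length cs
    squares≤ {n} small = go cs small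
      where
      go : ∀ cs → All (λ c → length c ≤ n) cs → ∑ (λ c → length c * length c) cs ≤ n * ∑ length cs
      go [] [] = z≤n
      go (c ∷ cs) (p ∷ ps) = ≤-trans (+-mono-≤ (*-monoˡ-≤ (length c) p) (go cs ps))
        (≤-reflexive (sym (*-distribˡ-+ n (length c) _)))

    -- A clustered vertex shares its cluster with at most n vertices. Outsiders are allotted n as
    -- well; their share later pays for the edges at the outsiders of the base colour.
    together-total : ∀ {n} → All (λ c → length c ≤ n) cs →
      ∑² (together cs) V + n * length outs ≤ n * length V
    together-total {n} small = begin
      ∑² (together cs) V + n * length outs
        ≡⟨ cong (_+ n * length outs) (trans (∑²-together cs V)
             (∑-cong cs (λ c → cong₂ _*_ (length-mult c) (length-mult c)))) ⟩
      ∑ (λ c → length c * length c) cs + n * length outs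
        ≤⟨ +-monoˡ-≤ _ (squares≤ small) ⟩
      n * ∑ length cs + n * length outs
        ≡⟨ *-distribˡ-+ n (∑ length cs) _ ⟨
      n * (∑ length cs + length outs)
        ≡⟨ cong (n *_) (trans (+-comm (∑ length cs) _) length-partition) ⟩
      n * length V ∎
      where open ≤-Reasoning

  module TwoPartitions (outs₀ : List A) (cs₀ : List (List A)) (V↭₀ : V ↭ outs₀ ++ concat cs₀)
    (outs₁ : List A) (cs₁ : List (List A)) (V↭₁ : V ↭ outs₁ ++ concat cs₁) where

    private
      module P₀ = Partition outs₀ cs₀ V↭₀
      module P₁ = Partition outs₁ cs₁ V↭₁

    meet : List A → List A → ℕ
    meet c c′ = ∑ (λ u → mult u c′) c

    common : ℕ
    common = ∑ (∑² (together cs₀)) cs₁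

    common-meet : common ≡ ∑ (λ c → ∑ (λ c′ → meet c c′ * meet c c′) cs₀) cs₁
    common-meet = ∑-cong cs₁ (∑²-together cs₀)

    -- A vertex that is an outsider of neither partition lies in exactly one intersection of
    -- clusters.
    meet-total : length V ≤ length outs₁ + length outs₀ + ∑ (λ c → ∑ (meet c) cs₀) cs₁
    meet-total = begin
      length V
        ≡⟨ P₁.length-partition ⟨
      length outs₁ + ∑ length cs₁
        ≡⟨ cong (length outs₁ +_) (∑-cong cs₁ (λ c → trans (sym (∑-one c))
             (trans (∑-cong c (λ u → sym (P₀.mult-partition u))) (∑-+ _ _ c)))) ⟩
      length outs₁ + ∑ (λ c → ∑ (λ u → mult u outs₀) c + ∑ (λ u → ∑ (mult u) cs₀) c) cs₁
        ≡⟨ cong (length outs₁ +_) (trans (∑-+ _ _ cs₁) (cong₂ _+_ (sym (∑-concat (λ u → mult u outs₀) cs₁))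
             (∑-cong cs₁ (λ c → ∑-swap mult c cs₀)))) ⟩
      length outs₁ + (∑ (λ u → mult u outs₀) (concat cs₁) + ∑ (λ c → ∑ (meet c) cs₀) cs₁)
        ≤⟨ +-monoʳ-≤ (length outs₁) (+-monoˡ-≤ _ outside) ⟩
      length outs₁ + (length outs₀ + ∑ (λ c → ∑ (meet c) cs₀) cs₁)
        ≡⟨ +-assoc (length outs₁) _ _ ⟨
      length outs₁ + length outs₀ + ∑ (λ c → ∑ (meet c) cs₀) cs₁ ∎
      where
      open ≤-Reasoning
      outside : ∑ (λ u → mult u outs₀) (concat cs₁) ≤ length outs₀
      outside = begin
        ∑ (λ u → mult u outs₀) (concat cs₁)             ≤⟨ m≤n+m _ _ ⟩
        ∑ (λ u → mult u outs₀) outs₁ + ∑ (λ u → mult u outs₀) (concat cs₁) ≡⟨ ∑-++ _ outs₁ (concat cs₁) ⟨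
        ∑ (λ u → mult u outs₀) (outs₁ ++ concat cs₁)    ≡⟨ ∑-↭ _ V↭₁ ⟨
        ∑ (λ u → mult u outs₀) V                        ≡⟨ length-mult outs₀ ⟩
        length outs₀                                    ∎

    -- (2 k p − n)² ≥ 0, summed over all pairs of clusters
    common-bound : ∀ k n → length cs₀ ≤ k → length cs₁ ≤ k →
      4 * k * n * ∑ (λ c → ∑ (meet c) cs₀) cs₁ ≤ 4 * k * k * common + k * k * (n * n)
    common-bound k n l₀ l₁ = begin
      4 * k * n * ∑ (λ c → ∑ (meet c) cs₀) cs₁
        ≡⟨ trans (sym (∑-*ˡ (4 * k * n) _ cs₁)) (∑-cong cs₁ (λ c → sym (∑-*ˡ (4 * k * n) (meet c) cs₀))) ⟩
      ∑ (λ c → ∑ (λ c′ → 4 * k * n * meet c c′) cs₀) cs₁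
        ≤⟨ ∑-mono cs₁ (λ c → ∑-mono cs₀ (λ c′ → am-gm (meet c c′))) ⟩
      ∑ (λ c → ∑ (λ c′ → 4 * k * k * (meet c c′ * meet c c′) + n * n) cs₀) cs₁
        ≡⟨ trans (∑-cong cs₁ (λ c → trans (∑-+ _ _ cs₀) (cong₂ _+_ (∑-*ˡ (4 * k * k) _ cs₀) (∑-const (n * n) cs₀))))
             (trans (∑-+ _ _ cs₁) (cong₂ _+_ (∑-*ˡ (4 * k * k) _ cs₁) (∑-const _ cs₁))) ⟩
      4 * k * k * ∑ (λ c → ∑ (λ c′ → meet c c′ * meet c c′) cs₀) cs₁ + length cs₁ * (length cs₀ * (n * n))
        ≡⟨ cong₂ (λ a b → 4 * k * k * a + b) (sym common-meet) (sym (*-assoc (length cs₁) (length cs₀) (n * n))) ⟩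
      4 * k * k * common + length cs₁ * length cs₀ * (n * n)
        ≤⟨ +-monoʳ-≤ (4 * k * k * common) (*-monoˡ-≤ (n * n) (*-mono-≤ l₁ l₀)) ⟩
      4 * k * k * common + k * k * (n * n) ∎
      where
      open ≤-Reasoning
      2ab≤a²+b² : ∀ a b → 2 * (a * b) ≤ a * a + b * b
      2ab≤a²+b² a b with ≤-total a b
      ... | inj₁ p with m≤n⇒∃[o]m+o≡n p
      ...   | d , refl = ≤-trans (m≤m+n _ (d * d)) (≤-reflexive (expand a d))
        where
        expand : ∀ a d → 2 * (a * (a + d)) + d * d ≡ a * a + (a + d) * (a + d)
        expand = solve-∀
      2ab≤a²+b² a b | inj₂ p with m≤n⇒∃[o]m+o≡n p
      ...   | d , refl = ≤-trans (m≤m+n _ (d * d)) (≤-reflexive (expand b d))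
        where
        expand : ∀ b d → 2 * ((b + d) * b) + d * d ≡ (b + d) * (b + d) + b * b
        expand = solve-∀
      am-gm : ∀ p → 4 * k * n * p ≤ 4 * k * k * (p * p) + n * n
      am-gm p = ≤-trans (≤-reflexive (left k n p)) (≤-trans (2ab≤a²+b² (2 * k * p) n) (≤-reflexive (right k n p)))
        where
        left : ∀ k n p → 4 * k * n * p ≡ 2 * (2 * k * p * n)
        left = solve-∀
        right : ∀ k n p → 2 * k * p * (2 * k * p) + n * n ≡ 4 * k * k * (p * p) + n * n
        right = solve-∀

    -- For values g, t ≤ 1 one has g + t ≤ 1 + g t. Summed over the pairs within members of `cs₁`,
    -- the t give `common`, the 1 gives at most n per clustered vertex, and the g t are the charged
    -- pairs.
    clustered-bound : ∀ {n} (g : A → A → Bool) → All (λ c → length c ≤ n) cs₁ →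
      ∑ (∑² (λ u v → ⟦ g u v ⟧)) cs₁ + n * length outs₁ + common ≤
      n * length V + ∑² (λ u v → ⟦ g u v ⟧ * together cs₀ u v) V
    clustered-bound {n} g small = begin
      e + n * length outs₁ + common
        ≡⟨ +-swap-last e (n * length outs₁) common ⟩
      e + common + n * length outs₁
        ≡⟨ cong (_+ n * length outs₁) (trans (sym (∑-+ _ _ cs₁)) (∑-cong cs₁ (λ c → sym (∑²-+ _ _ c)))) ⟩
      ∑ (∑² (λ u v → ⟦ g u v ⟧ + together cs₀ u v)) cs₁ + n * length outs₁
        ≤⟨ +-monoˡ-≤ _ (∑-mono cs₁ (λ c → ∑²-mono c (λ u v → pointwise (g u v) (P₀.together≤1 u v)))) ⟩
      ∑ (∑² (λ u v → 1 + f u v)) cs₁ + n * length outs₁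
        ≡⟨ cong (_+ n * length outs₁) (trans (∑-cong cs₁ (λ c → ∑²-+ (λ _ _ → 1) f c)) (∑-+ _ _ cs₁)) ⟩
      ∑ (∑² (λ _ _ → 1)) cs₁ + ∑ (∑² f) cs₁ + n * length outs₁
        ≤⟨ +-monoˡ-≤ _ (+-mono-≤ squares (P₁.∑-clusters≤ f)) ⟩
      n * ∑ length cs₁ + ∑² f V + n * length outs₁
        ≡⟨ arrange n (∑ length cs₁) (∑² f V) (length outs₁) ⟩
      n * (length outs₁ + ∑ length cs₁) + ∑² f V
        ≡⟨ cong (λ t → n * t + ∑² f V) P₁.length-partition ⟩
      n * length V + ∑² f V ∎
      where
      open ≤-Reasoning
      e = ∑ (∑² (λ u v → ⟦ g u v ⟧)) cs₁
      f : A → A → ℕ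
      f u v = ⟦ g u v ⟧ * together cs₀ u v
      arrange : ∀ n a b c → n * a + b + n * c ≡ n * (c + a) + b
      arrange = solve-∀
      pointwise : ∀ b {q} → q ≤ 1 → ⟦ b ⟧ + q ≤ 1 + ⟦ b ⟧ * q
      pointwise true {q} _ = ≤-reflexive (cong suc (sym (+-identityʳ q)))
      pointwise false q≤1 = q≤1
      squares : ∑ (∑² (λ _ _ → 1)) cs₁ ≤ n * ∑ length cs₁
      squares = ≤-trans (≤-reflexive (∑-cong cs₁ (λ c → trans (∑-cong c (λ _ → ∑-one c)) (∑-const (length c) c))))
        (P₁.squares≤ small)

-- For k = 4 + j the coefficient 4 k² − k + 2 is 62 + 31 j + 4 j².
coeff : ℕ → ℕ
coeff j = 62 + 31 * j + 4 * (j * j)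

-- The numerical inequalities

module Arithmetic (k j n N : ℕ) (k≡4+j : k ≡ 4 + j) (n-large : 64 * k ≤ n) where

  private
    A = coeff j * n

  4kn≤n² : 4 * k * n ≤ n * n
  4kn≤n² = *-monoˡ-≤ n (≤-trans (*-monoˡ-≤ k (m≤m+n 4 60)) n-large)

  -- The overlap is at least n Z/k - n²/4 with Z ≥ N - 2n. Since N is about (k - 1/4 + 1/(2k)) n,
  -- this is at least n²/4 - 3n²/(4k²) for k ≥ 4, even after rounding N down.
  clustered-deficit : ∀ {e m common Z O₀ O₁} → A ≤ 4 * k * N + 4 * k →
    e + common ≤ n * N + m → 4 * k * n * Z ≤ 4 * k * k * common + k * k * (n * n) →
    N ≤ O₁ + O₀ + Z → O₀ ≤ n → O₁ ≤ n →
    4 * k * k * e + k * k * (n * n) ≤ 4 * k * k * (n * N + m) + 3 * (n * n)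
  clustered-deficit {e} {m} {common} {Z} {O₀} {O₁} A≤ h₁ h₂ h₃ o₀ o₁ =
    +-cancelʳ-≤ X _ _ (begin
      4 * k * k * e + k * k * (n * n) + X
        ≡⟨ +-assoc (4 * k * k * e) _ _ ⟩
      4 * k * k * e + (k * k * (n * n) + X)
        ≤⟨ +-monoʳ-≤ (4 * k * k * e) room ⟩
      4 * k * k * e + (A * n + 3 * (n * n))
        ≤⟨ +-monoʳ-≤ (4 * k * k * e) (+-monoˡ-≤ (3 * (n * n)) An≤) ⟩
      4 * k * k * e + (4 * k * n * Z + (8 * k * (n * n) + 4 * k * n) + 3 * (n * n))
        ≤⟨ +-monoʳ-≤ (4 * k * k * e) (+-monoˡ-≤ (3 * (n * n)) (+-monoˡ-≤ _ h₂)) ⟩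
      4 * k * k * e + (4 * k * k * common + k * k * (n * n) + (8 * k * (n * n) + 4 * k * n) + 3 * (n * n))
        ≡⟨ collect (4 * k * k) e common (k * k * (n * n)) (8 * k * (n * n) + 4 * k * n) (3 * (n * n)) ⟩
      4 * k * k * (e + common) + 3 * (n * n) + X
        ≤⟨ +-monoˡ-≤ X (+-monoˡ-≤ (3 * (n * n)) (*-monoʳ-≤ (4 * k * k) h₁)) ⟩
      4 * k * k * (n * N + m) + 3 * (n * n) + X ∎)
    where
    open ≤-Reasoning
    X = k * k * (n * n) + (8 * k * (n * n) + 4 * k * n)
    collect : ∀ c e q a b d → c * e + (c * q + a + b + d) ≡ c * (e + q) + d + (a + b)
    collect = solve-∀
    An≤ : A * n ≤ 4 * k * n * Z + (8 * k * (n * n) + 4 * k * n)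
    An≤ = begin
      A * n                                            ≤⟨ *-monoˡ-≤ n A≤ ⟩
      (4 * k * N + 4 * k) * n                          ≤⟨ *-monoˡ-≤ n (+-monoˡ-≤ (4 * k) (*-monoʳ-≤ (4 * k)
                                                            (≤-trans h₃ (+-monoˡ-≤ Z (+-mono-≤ o₁ o₀))))) ⟩
      (4 * k * (n + n + Z) + 4 * k) * n                ≡⟨ expand k n Z ⟩
      4 * k * n * Z + (8 * k * (n * n) + 4 * k * n)    ∎
      where
      expand : ∀ k n Z → (4 * k * (n + n + Z) + 4 * k) * n ≡ 4 * k * n * Z + (8 * k * (n * n) + 4 * k * n)
      expand = solve-∀
    room : k * k * (n * n) + X ≤ A * n + 3 * (n * n)
    room = begin
      k * k * (n * n) + (k * k * (n * n) + (8 * k * (n * n) + 4 * k * n))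
        ≤⟨ +-monoʳ-≤ (k * k * (n * n)) (+-monoʳ-≤ (k * k * (n * n)) (+-monoʳ-≤ (8 * k * (n * n)) 4kn≤n²)) ⟩
      k * k * (n * n) + (k * k * (n * n) + (8 * k * (n * n) + n * n))
        -- The excess is (2k - 1)(k - 4). It vanishes at k = 4, which fixes the constant 3.
        ≤⟨ m≤m+n _ ((7 * j + 2 * (j * j)) * (n * n)) ⟩
      k * k * (n * n) + (k * k * (n * n) + (8 * k * (n * n) + n * n)) + (7 * j + 2 * (j * j)) * (n * n)
        ≡⟨ subst (λ k → k * k * (n * n) + (k * k * (n * n) + (8 * k * (n * n) + n * n))
             + (7 * j + 2 * (j * j)) * (n * n) ≡ A * n + 3 * (n * n)) (sym k≡4+j) (expand j n) ⟩
      A * n + 3 * (n * n) ∎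
      where
      expand : ∀ j n →
        (4 + j) * (4 + j) * (n * n) + ((4 + j) * (4 + j) * (n * n) + (8 * (4 + j) * (n * n) + n * n))
          + (7 * j + 2 * (j * j)) * (n * n)
        ≡ (62 + 31 * j + 4 * (j * j)) * n * n + 3 * (n * n)
      expand = solve-∀

  -- In terms of y = 4kN, which lies between A - 4k and A, the count becomes quadratic. Rounding and
  -- the diagonal of K_N contribute 4k y each; after multiplication by 8 the hypothesis 64k ≤ n
  -- bounds both by n y, and y ≤ A leaves only multiples of n².
  contradiction : 4 * k * N ≤ A → A ≤ 4 * k * N + 4 * k →
    4 * k * k * (N * N) + k * (k * k * (n * n)) + 3 * (n * n) ≤
    4 * k * k * N + k * (4 * k * k * (n * N) + 3 * (n * n)) + k * k * (n * n) → ⊥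
  contradiction ≤A A≤ h = <⇒≱ (m<m+n _ positive) impossible
    where
    open ≤-Reasoning
    y = 4 * k * N
    -- The coefficient of n² on the right once y has been replaced by A; the left side exceeds it by
    -- `194 + 161 * j + 36 * (j * j)`.
    L = 1950 + 1375 * j + 348 * (j * j) + 32 * (j * j * j)
    n-positive : 0 < n
    n-positive = ≤-trans (m≤m+n 1 255) (≤-trans
      (*-monoʳ-≤ 64 (≤-trans (m≤m+n 4 j) (≤-reflexive (sym k≡4+j)))) n-large)
    positive : 0 < (194 + 161 * j + 36 * (j * j)) * (n * n)
    positive = *-mono-< (z<s {193 + 161 * j + 36 * (j * j)}) (*-mono-< n-positive n-positive)
    first : y * y + (4 * (k * (k * k * (n * n))) + 12 * (n * n)) ≤
            y * y + (8 * k * y + (2 + j) * n * y + (12 * k * (n * n) + 4 * k * k * (n * n)))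
    first = begin
      y * y + (4 * (k * (k * k * (n * n))) + 12 * (n * n))
        ≡⟨ e₁ k n N ⟩
      4 * (4 * k * k * (N * N) + k * (k * k * (n * n)) + 3 * (n * n))
        ≤⟨ *-monoʳ-≤ 4 h ⟩
      4 * (4 * k * k * N + k * (4 * k * k * (n * N) + 3 * (n * n)) + k * k * (n * n))
        -- 16k³ n N = 4k² n y, and 4k² is `coeff j` plus k - 2 = 2 + j.
        ≡⟨ subst (λ k → 4 * (4 * k * k * N + k * (4 * k * k * (n * N) + 3 * (n * n)) + k * k * (n * n)) ≡
             A * (4 * k * N) + (4 * k * (4 * k * N) + (2 + j) * n * (4 * k * N)
               + (12 * k * (n * n) + 4 * k * k * (n * n)))) (sym k≡4+j) (e₂ j n N) ⟩
      A * y + (4 * k * y + (2 + j) * n * y + (12 * k * (n * n) + 4 * k * k * (n * n)))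
        ≤⟨ +-monoˡ-≤ _ (*-monoˡ-≤ y A≤) ⟩
      (y + 4 * k) * y + (4 * k * y + (2 + j) * n * y + (12 * k * (n * n) + 4 * k * k * (n * n)))
        ≡⟨ e₃ y k ((2 + j) * n * y) (12 * k * (n * n) + 4 * k * k * (n * n)) ⟩
      y * y + (8 * k * y + (2 + j) * n * y + (12 * k * (n * n) + 4 * k * k * (n * n))) ∎
      where
      e₁ : ∀ k n N → 4 * k * N * (4 * k * N) + (4 * (k * (k * k * (n * n))) + 12 * (n * n)) ≡
           4 * (4 * k * k * (N * N) + k * (k * k * (n * n)) + 3 * (n * n))
      e₁ = solve-∀
      e₂ : ∀ j n N →
           4 * (4 * (4 + j) * (4 + j) * N
             + (4 + j) * (4 * (4 + j) * (4 + j) * (n * N) + 3 * (n * n)) + (4 + j) * (4 + j) * (n * n)) ≡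
           (62 + 31 * j + 4 * (j * j)) * n * (4 * (4 + j) * N)
             + (4 * (4 + j) * (4 * (4 + j) * N) + (2 + j) * n * (4 * (4 + j) * N)
               + (12 * (4 + j) * (n * n) + 4 * (4 + j) * (4 + j) * (n * n)))
      e₂ = solve-∀
      e₃ : ∀ y k a b → (y + 4 * k) * y + (4 * k * y + a + b) ≡ y * y + (8 * k * y + a + b)
      e₃ = solve-∀
    impossible : L * (n * n) + (194 + 161 * j + 36 * (j * j)) * (n * n) ≤ L * (n * n)
    impossible = begin
      L * (n * n) + (194 + 161 * j + 36 * (j * j)) * (n * n)
        ≡⟨ subst (λ k → L * (n * n) + (194 + 161 * j + 36 * (j * j)) * (n * n) ≡
             8 * (4 * (k * (k * k * (n * n))) + 12 * (n * n))) (sym k≡4+j) (e₄ j n) ⟩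
      8 * (4 * (k * (k * k * (n * n))) + 12 * (n * n))
        ≤⟨ *-monoʳ-≤ 8 (+-cancelˡ-≤ (y * y) _ _ first) ⟩
      8 * (8 * k * y + (2 + j) * n * y + (12 * k * (n * n) + 4 * k * k * (n * n)))
        ≡⟨ e₅ k j n y ⟩
      64 * k * y + ((16 + 8 * j) * n * y + (96 * k * (n * n) + 32 * k * k * (n * n)))
        ≤⟨ +-monoˡ-≤ _ (*-monoˡ-≤ y n-large) ⟩
      n * y + ((16 + 8 * j) * n * y + (96 * k * (n * n) + 32 * k * k * (n * n)))
        ≡⟨ e₆ j n y (96 * k * (n * n) + 32 * k * k * (n * n)) ⟩
      (17 + 8 * j) * n * y + (96 * k * (n * n) + 32 * k * k * (n * n))
        ≤⟨ +-monoˡ-≤ _ (*-monoʳ-≤ ((17 + 8 * j) * n) ≤A) ⟩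
      (17 + 8 * j) * n * A + (96 * k * (n * n) + 32 * k * k * (n * n))
        ≡⟨ subst (λ k → (17 + 8 * j) * n * A + (96 * k * (n * n) + 32 * k * k * (n * n)) ≡ L * (n * n))
             (sym k≡4+j) (e₇ j n) ⟩
      L * (n * n) ∎
      where
      e₄ : ∀ j n → (1950 + 1375 * j + 348 * (j * j) + 32 * (j * j * j)) * (n * n)
             + (194 + 161 * j + 36 * (j * j)) * (n * n) ≡
           8 * (4 * ((4 + j) * ((4 + j) * (4 + j) * (n * n))) + 12 * (n * n))
      e₄ = solve-∀
      e₅ : ∀ k j n y → 8 * (8 * k * y + (2 + j) * n * y + (12 * k * (n * n) + 4 * k * k * (n * n))) ≡
           64 * k * y + ((16 + 8 * j) * n * y + (96 * k * (n * n) + 32 * k * k * (n * n)))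
      e₅ = solve-∀
      e₆ : ∀ j n y a → n * y + ((16 + 8 * j) * n * y + a) ≡ (17 + 8 * j) * n * y + a
      e₆ = solve-∀
      e₇ : ∀ j n → (17 + 8 * j) * n * ((62 + 31 * j + 4 * (j * j)) * n)
             + (96 * (4 + j) * (n * n) + 32 * (4 + j) * (4 + j) * (n * n)) ≡
           (1950 + 1375 * j + 348 * (j * j) + 32 * (j * j * j)) * (n * n)
      e₇ = solve-∀

-- Colour classes of the complete graph

∑-map : ∀ {A B : Set} (f : B → ℕ) (g : A → B) l → ∑ f (map g l) ≡ ∑ (f ∘ g) l
∑-map f g [] = refl
∑-map f g (x ∷ l) = cong (f (g x) +_) (∑-map f g l)

mult-allFin : ∀ {N} (u : Fin N) → Multiplicity.mult Fin._≟_ u (allFin N) ≡ 1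
mult-allFin {suc N} u rewrite sym (map-tabulate {n = N} id Fin.suc) = go u
  where
  open Multiplicity (Fin._≟_ {suc N})
  go : ∀ u → mult u (Fin.zero ∷ map Fin.suc (allFin N)) ≡ 1
  go Fin.zero = cong suc (trans (∑-map _ Fin.suc (allFin N)) (∑≡0 (allFin N) (λ _ → refl)))
  go (Fin.suc u) = trans (∑-map _ Fin.suc (allFin N)) (mult-allFin u)

choose : ∀ {A : Set} {P Q : A → Set} l → (∀ x → P x ⊎ Q x) → (∀ {x} → x ∈ l → P x) ⊎ ∃ Q
choose [] h = inj₁ λ ()
choose (x ∷ l) h with h x | choose l h
... | inj₂ q | _ = inj₂ (x , q)
... | inj₁ p | inj₂ q = inj₂ q
... | inj₁ p | inj₁ ps = inj₁ λ { (here refl) → p ; (there x∈) → ps x∈ }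

-- The counting only refutes the absence of a path. Exhaustive search makes the question decidable,
-- so that an actual path can be returned.
∃-list? : ∀ {N} m {P : List (Fin N) → Set} → (∀ l → Dec (P l)) → Dec (∃ λ l → length l ≡ m × P l)
∃-list? zero P? = map′ (λ p → [] , refl , p) (λ { ([] , _ , p) → p }) (P? [])
∃-list? (suc m) P? = map′ (λ { (x , l , eq , p) → x ∷ l , cong suc eq , p })
  (λ { (x ∷ l , eq , p) → x , l , suc-injective eq , p })
  (any? (λ x → ∃-list? m (λ l → P? (x ∷ l))))

module Colours {k N : ℕ} (c : Colouring k N) where

  open Multiplicity (Fin._≟_ {N})

  G : Fin k → Fin N → Fin N → Bool
  G a u v = not (does (u Fin.≟ v)) ∧ does (col c u v Fin.≟ a)

  G-sym : ∀ a u v → G a u v ≡ G a v u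
  G-sym a u v rewrite Defs.Colouring.sym c u v with u Fin.≟ v | v Fin.≟ u
  ... | yes _ | yes _ = refl
  ... | yes u≡v | no v≢u = ⊥-elim (v≢u (sym u≡v))
  ... | no u≢v | yes v≡u = ⊥-elim (u≢v (sym v≡u))
  ... | no _ | no _ = refl

  G-irrefl : ∀ a u → G a u u ≡ false
  G-irrefl a u rewrite dec-true (u Fin.≟ u) refl = refl

  G⇒col : ∀ a u v → G a u v ≡ true → col c u v ≡ a
  G⇒col a u v h with u Fin.≟ v | col c u v Fin.≟ a
  ... | no _ | yes eq = eq

  path-defects : Fin k → List (Fin N) → ℕ
  path-defects a [] = 0
  path-defects a (x ∷ l) = Defects.defects (G a) x l

  Path : Fin k → List (Fin N) → Set
  Path a l = Distinct l × path-defects a l ≡ 0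

  path? : ∀ a l → Dec (Path a l)
  path? a l = all? (λ u → mult u l ≤? 1) ×-dec (path-defects a l ℕ.≟ 0)

  lookup-injective : ∀ l → Distinct l → ∀ {i j} → lookup l i ≡ lookup l j → i ≡ j
  lookup-injective (x ∷ l) d {Fin.zero} {Fin.zero} eq = refl
  lookup-injective (x ∷ l) d {Fin.zero} {Fin.suc j} eq = ⊥-elim (distinct-head l d (∈-lookup j) eq)
  lookup-injective (x ∷ l) d {Fin.suc i} {Fin.zero} eq = ⊥-elim (distinct-head l d (∈-lookup i) (sym eq))
  lookup-injective (x ∷ l) d {Fin.suc i} {Fin.suc j} eq =
    cong Fin.suc (lookup-injective l (distinct-tail x l d) eq)

  lookup-adjacent : ∀ a l → path-defects a l ≡ 0 → ∀ i j → Fin.toℕ j ≡ suc (Fin.toℕ i) →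
    col c (lookup l i) (lookup l j) ≡ a
  lookup-adjacent a (x ∷ y ∷ l) p Fin.zero (Fin.suc Fin.zero) refl = G⇒col a x y (edge (m+n≡0⇒m≡0 _ p))
    where
    edge : ⟦ not (G a x y) ⟧ ≡ 0 → G a x y ≡ true
    edge h with G a x y
    ... | true = refl
  lookup-adjacent a (x ∷ y ∷ l) p (Fin.suc i) (Fin.suc j) eq =
    lookup-adjacent a (y ∷ l) (m+n≡0⇒n≡0 (Defects.b (G a) x y) p) i j (suc-injective eq)

  path⇒monoPath : ∀ {a} l → Path a l → MonoPath c (length l)
  path⇒monoPath {a} l (d , p) = a , lookup l , lookup-injective l d , lookup-adjacent a l p

  V : List (Fin N)
  V = allFin N

  V-length : length V ≡ N
  V-length = length-tabulate id

  edges : Fin k → ℕ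
  edges a = ∑² (λ u v → ⟦ G a u v ⟧) V

  ∑-G : ∀ u v → ∑ (λ a → ⟦ G a u v ⟧) (allFin k) + δ u v ≡ 1
  ∑-G u v with u Fin.≟ v
  ... | yes _ = cong (_+ 1) (∑≡0 (allFin k) (λ _ → refl))
  ... | no _ = trans (+-identityʳ _) (mult-allFin (col c u v))

  ∑-G≤1 : ∀ u v → ∑ (λ a → ⟦ G a u v ⟧) (allFin k) ≤ 1
  ∑-G≤1 u v = ≤-trans (m≤m+n _ (δ u v)) (≤-reflexive (∑-G u v))

  all-edges : ∑ edges (allFin k) + N ≡ N * N
  all-edges = begin
    ∑ edges (allFin k) + N
      ≡⟨ cong₂ _+_ (∑²-∑ (λ a u v → ⟦ G a u v ⟧) (allFin k) V) (sym V-length) ⟩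
    ∑² (λ u v → ∑ (λ a → ⟦ G a u v ⟧) (allFin k)) V + length V
      ≡⟨ cong (∑² (λ u v → ∑ (λ a → ⟦ G a u v ⟧) (allFin k)) V +_)
           (trans (sym (∑-one V)) (∑-cong V (λ u → sym (mult-allFin u)))) ⟩
    ∑² (λ u v → ∑ (λ a → ⟦ G a u v ⟧) (allFin k)) V + ∑² δ V
      ≡⟨ ∑²-+ _ _ V ⟨
    ∑² (λ u v → ∑ (λ a → ⟦ G a u v ⟧) (allFin k) + δ u v) V
      ≡⟨ ∑-cong V (λ u → trans (∑-cong V (∑-G u)) (∑-one V)) ⟩
    ∑ (λ _ → length V) V
      ≡⟨ trans (∑-const (length V) V) (cong₂ _*_ V-length V-length) ⟩
    N * N ∎
    where open ≡-Reasoning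

-- Adding up the colours

module NoPath (k j n N : ℕ) (k≡4+j : k ≡ 4 + j) (n-large : 64 * k ≤ n)
  (≤A : 4 * k * N ≤ coeff j * n) (A≤ : coeff j * n ≤ 4 * k * N + 4 * k)
  (c : Colouring k N)
  (no-path : ∀ a l → length l ≡ n → ¬ Colours.Path c a l) where

  open Colours c
  open Multiplicity (Fin._≟_ {N}) using (Distinct; distinct-↭; distinct-++ˡ)
  open Overlap (Fin._≟_ {N}) V mult-allFin
  open Arithmetic k j n N k≡4+j n-large

  4≤k : 4 ≤ k
  4≤k = ≤-trans (m≤m+n 4 j) (≤-reflexive (sym k≡4+j))

  2≤n : 2 ≤ n
  2≤n = ≤-trans (m≤m+n 2 254) (≤-trans (*-monoʳ-≤ 64 4≤k) n-large)

  instance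
    k-nonZero : NonZero k
    k-nonZero = >-nonZero (≤-trans (s≤s z≤n) 4≤k)
    n-nonZero : NonZero n
    n-nonZero = >-nonZero (≤-trans (s≤s z≤n) 2≤n)

  V-distinct : Distinct V
  V-distinct u = ≤-reflexive (mult-allFin u)

  module Colour (a : Fin k) =
    PathFree (Fin._≟_ {N}) (G a) (G-sym a) (G-irrefl a) n 2≤n V V-distinct
      (λ x l R V↭ path len → no-path a (x ∷ l) len
        (distinct-++ˡ (x ∷ l) R (distinct-↭ V↭ V-distinct) , path))

  N≤kn : N ≤ k * n
  N≤kn = *-cancelˡ-≤ (4 * k) {{m*n≢0 4 k}} (≤-trans ≤A (≤-trans (m≤m+n (coeff j * n) ((2 + j) * n))
    (≤-reflexive (subst (λ k → coeff j * n + (2 + j) * n ≡ 4 * k * (k * n)) (sym k≡4+j) (expand j n)))))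
    where
    expand : ∀ j n → (62 + 31 * j + 4 * (j * j)) * n + (2 + j) * n ≡ 4 * (4 + j) * ((4 + j) * n)
    expand = solve-∀

  -- With N ≤ k n the hypothesis says 2m ≤ 2k + 1, and integrality removes the extra half.
  cluster-count : ∀ m → 2 * (n * m) ≤ 2 * length V + n → m ≤ k
  cluster-count m h = s≤s⁻¹ (*-cancelˡ-< 2 m (suc k) (*-cancelˡ-< n (2 * m) (2 * suc k) (begin-strict
    n * (2 * m)          ≡⟨ move n m ⟩
    2 * (n * m)          ≤⟨ h ⟩
    2 * length V + n     ≡⟨ cong (λ t → 2 * t + n) V-length ⟩
    2 * N + n            ≤⟨ +-monoˡ-≤ n (*-monoʳ-≤ 2 N≤kn) ⟩
    2 * (k * n) + n      <⟨ m<m+n _ (>-nonZero⁻¹ n) ⟩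
    2 * (k * n) + n + n  ≡⟨ collect k n ⟩
    n * (2 * suc k)      ∎)))
    where
    open ≤-Reasoning
    move : ∀ n m → n * (2 * m) ≡ 2 * (n * m)
    move = solve-∀
    collect : ∀ k n → 2 * (k * n) + n + n ≡ n * (2 * suc k)
    collect = solve-∀

  -- 4k² times the allowance n N of one colour, plus the loss 3n² of `clustered-deficit`.
  K : ℕ
  K = 4 * k * k * (n * N) + 3 * (n * n)

  sparse-deficit : ∀ a → Colour.Sparse a → 4 * k * k * edges a + k * k * (n * n) ≤ 4 * k * k * (n * N)
  sparse-deficit a h = begin
    4 * k * k * edges a + k * k * (n * n)  ≡⟨ collect k (edges a) (n * n) ⟩
    k * k * (4 * edges a + n * n)          ≤⟨ *-monoʳ-≤ (k * k) h ⟩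
    k * k * (4 * (n * length V))           ≡⟨ cong (λ t → k * k * (4 * (n * t))) V-length ⟩
    k * k * (4 * (n * N))                  ≡⟨ move k (n * N) ⟩
    4 * k * k * (n * N)                    ∎
    where
    open ≤-Reasoning
    collect : ∀ k e m → 4 * k * k * e + k * k * m ≡ k * k * (4 * e + m)
    collect = solve-∀
    move : ∀ k m → k * k * (4 * m) ≡ 4 * k * k * m
    move = solve-∀

  -- Common end of both cases: k - 1 colours bear a deficit, while `K` on the left and k² n² on the
  -- right leave one colour with its full n N.
  conclude : 4 * k * k * ∑ edges (allFin k) + k * (k * k * (n * n)) + K ≤
             4 * k * k * (n * N) + k * K + k * k * (n * n) → ⊥
  conclude h = contradiction ≤A A≤ (+-cancelʳ-≤ (4 * k * k * (n * N)) _ _ (begin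
    4 * k * k * (N * N) + k * (k * k * (n * n)) + 3 * (n * n) + 4 * k * k * (n * N)
      ≡⟨ cong (λ t → 4 * k * k * t + k * (k * k * (n * n)) + 3 * (n * n) + 4 * k * k * (n * N)) all-edges ⟨
    4 * k * k * (e + N) + k * (k * k * (n * n)) + 3 * (n * n) + 4 * k * k * (n * N)
      ≡⟨ collect (4 * k * k) e N (k * (k * k * (n * n))) (3 * (n * n)) (n * N) ⟩
    4 * k * k * e + k * (k * k * (n * n)) + K + 4 * k * k * N
      ≤⟨ +-monoˡ-≤ (4 * k * k * N) h ⟩
    4 * k * k * (n * N) + k * K + k * k * (n * n) + 4 * k * k * N
      ≡⟨ rotate (4 * k * k * (n * N)) (k * K) (k * k * (n * n)) (4 * k * k * N) ⟩
    4 * k * k * N + k * K + k * k * (n * n) + 4 * k * k * (n * N) ∎))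
    where
    open ≤-Reasoning
    e = ∑ edges (allFin k)
    collect : ∀ q e N a b z → q * (e + N) + a + b + q * z ≡ q * e + a + (q * z + b) + q * N
    collect = solve-∀
    rotate : ∀ a b c d → a + b + c + d ≡ d + b + c + a
    rotate = solve-∀

  all-sparse : (∀ {a} → a ∈ allFin k → Colour.Sparse a) → ⊥
  all-sparse h = conclude (begin
    4 * k * k * ∑ edges (allFin k) + k * (k * k * (n * n)) + K
      ≡⟨ cong (_+ K) (cong₂ _+_ (sym (∑-*ˡ (4 * k * k) edges (allFin k)))
           (trans (cong (_* (k * k * (n * n))) (sym (length-tabulate {n = k} id))) (sym (∑-const (k * k * (n * n)) (allFin k))))) ⟩
    ∑ (λ a → 4 * k * k * edges a) (allFin k) + ∑ (λ _ → k * k * (n * n)) (allFin k) + K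
      ≡⟨ cong (_+ K) (∑-+ _ _ (allFin k)) ⟨
    ∑ (λ a → 4 * k * k * edges a + k * k * (n * n)) (allFin k) + K
      ≤⟨ +-monoˡ-≤ K (∑-mono-∈ (allFin k) (λ {a} a∈ → ≤-trans (sparse-deficit a (h a∈)) (m≤m+n _ (3 * (n * n))))) ⟩
    ∑ (λ _ → K) (allFin k) + K
      ≡⟨ cong (_+ K) (trans (∑-const K (allFin k)) (cong (_* K) (length-tabulate {n = k} id))) ⟩
    k * K + K
      ≡⟨ +-comm (k * K) K ⟩
    4 * k * k * (n * N) + 3 * (n * n) + k * K
      -- Every colour has a deficit here; that of one colour is given away to fit `conclude`.
      ≤⟨ +-monoˡ-≤ (k * K) (+-monoʳ-≤ (4 * k * k * (n * N)) (*-monoˡ-≤ (n * n) 3≤k²)) ⟩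
    4 * k * k * (n * N) + k * k * (n * n) + k * K
      ≡⟨ +-swap-last (4 * k * k * (n * N)) (k * k * (n * n)) (k * K) ⟩
    4 * k * k * (n * N) + k * K + k * k * (n * n) ∎)
    where
    open ≤-Reasoning
    3≤k² : 3 ≤ k * k
    3≤k² = ≤-trans (m≤m+n 3 13) (*-mono-≤ 4≤k 4≤k)

  module Base (a₀ : Fin k) (cl₀ : Colour.Clustered a₀) where

    open PathFree.Clustered cl₀ using () renaming (outs to outs₀; clusters to cs₀;
      partition to V↭₀; outs-few to few₀; clusters-small to small₀; clusters-few to count₀; edges-bound to bound₀)
    private
      module P₀ = Partition outs₀ cs₀ V↭₀
      O = length outs₀

    inside : Fin k → ℕ
    inside a = ∑² (λ u v → ⟦ G a u v ⟧ * together cs₀ u v) V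

    -- Each pair has at most one colour, so the charges share the pairs within the clusters of `a₀`.
    -- The term `n * O` reserves room for `base-bound`.
    ∑-inside : ∑ inside (allFin k) + n * O ≤ n * N
    ∑-inside = begin
      ∑ inside (allFin k) + n * O
        ≡⟨ cong (_+ n * O) (trans (∑²-∑ (λ a u v → ⟦ G a u v ⟧ * together cs₀ u v) (allFin k) V)
             (∑-cong V (λ u → ∑-cong V (λ v → ∑-*ʳ (together cs₀ u v) (λ a → ⟦ G a u v ⟧) (allFin k))))) ⟩
      ∑² (λ u v → ∑ (λ a → ⟦ G a u v ⟧) (allFin k) * together cs₀ u v) V + n * O
        ≤⟨ +-monoˡ-≤ (n * O) (∑²-mono V (λ u v → ≤-trans
             (*-monoˡ-≤ (together cs₀ u v) (∑-G≤1 u v)) (≤-reflexive (*-identityˡ _)))) ⟩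
      ∑² (together cs₀) V + n * O
        ≤⟨ P₀.together-total small₀ ⟩
      n * length V
        ≡⟨ cong (n *_) V-length ⟩
      n * N ∎
      where open ≤-Reasoning

    base-bound : edges a₀ ≤ inside a₀ + n * O
    base-bound = ≤-trans bound₀ (≤-reflexive (cong (_+ n * O) (∑-clusters (λ u v → ⟦ G a₀ u v ⟧) cs₀)))

    other-bound : ∀ a → Colour.Sparse a ⊎ Colour.Clustered a →
      4 * k * k * edges a + k * k * (n * n) ≤ 4 * k * k * (n * N + inside a) + 3 * (n * n)
    other-bound a (inj₁ sparse) = ≤-trans (sparse-deficit a sparse)
      (≤-trans (*-monoʳ-≤ (4 * k * k) (m≤m+n (n * N) (inside a))) (m≤m+n _ _))
    other-bound a (inj₂ cl) =
      clustered-deficit A≤ h₁ (common-bound k n (cluster-count _ count₀) (cluster-count _ clusters-few))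
        (≤-trans (≤-reflexive (sym V-length)) meet-total) few₀ outs-few
      where
      open PathFree.Clustered cl
      open TwoPartitions outs₀ cs₀ V↭₀ outs clusters partition
      h₁ : edges a + common ≤ n * N + inside a
      h₁ = ≤-trans (+-monoˡ-≤ common edges-bound)
        (≤-trans (clustered-bound (G a) clusters-small) (≤-reflexive (cong (λ t → n * t + inside a) V-length)))

    private
      open Multiplicity (Fin._≟_ {k}) using () renaming (δ to δₖ)
      E = 4 * k * k * (n * O) + k * k * (n * n)

    -- The terms with `δₖ` replace `K` by `E` at `a₀`, so that a single sum over all colours covers
    -- the exceptional one.
    pointwise : ∀ a → Colour.Sparse a ⊎ Colour.Clustered a →
      4 * k * k * edges a + k * k * (n * n) + δₖ a₀ a * K ≤ 4 * k * k * inside a + K + δₖ a₀ a * E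
    pointwise a h with a₀ Fin.≟ a
    ... | no _ = subst₂ _≤_ (sym (+-identityʳ _))
      (trans (collect (4 * k * k) (n * N) (inside a) (3 * (n * n))) (sym (+-identityʳ _))) (other-bound a h)
      where
      collect : ∀ q a b c → q * (a + b) + c ≡ q * b + (q * a + c)
      collect = solve-∀
    ... | yes refl = begin
      4 * k * k * edges a + k * k * (n * n) + 1 * K
        ≤⟨ +-monoˡ-≤ (1 * K) (+-monoˡ-≤ (k * k * (n * n)) (*-monoʳ-≤ (4 * k * k) base-bound)) ⟩
      4 * k * k * (inside a + n * O) + k * k * (n * n) + 1 * K
        ≡⟨ collect (4 * k * k) (inside a) (n * O) (k * k * (n * n)) K ⟩
      4 * k * k * inside a + K + 1 * E ∎
      where
      open ≤-Reasoning
      collect : ∀ q a b c z → q * (a + b) + c + 1 * z ≡ q * a + z + 1 * (q * b + c)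
      collect = solve-∀

    ∑-δ : ∀ z → ∑ (λ a → δₖ a₀ a * z) (allFin k) ≡ z
    ∑-δ z = trans (∑-*ʳ z (δₖ a₀) (allFin k)) (trans (cong (_* z) (mult-allFin a₀)) (*-identityˡ z))

    ∑-constₖ : ∀ z → ∑ (λ _ → z) (allFin k) ≡ k * z
    ∑-constₖ z = trans (∑-const z (allFin k)) (cong (_* z) (length-tabulate {n = k} id))

    impossible : (∀ a → Colour.Sparse a ⊎ Colour.Clustered a) → ⊥
    impossible h = conclude (begin
      4 * k * k * ∑ edges (allFin k) + k * (k * k * (n * n)) + K
        ≡⟨ cong₂ _+_ (cong₂ _+_ (∑-*ˡ (4 * k * k) edges (allFin k)) (∑-constₖ (k * k * (n * n)))) (∑-δ K) ⟨
      ∑ (λ a → 4 * k * k * edges a) (allFin k) + ∑ (λ _ → k * k * (n * n)) (allFin k) + ∑ (λ a → δₖ a₀ a * K) (allFin k)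
        ≡⟨ trans (∑-+ _ _ (allFin k)) (cong (_+ ∑ (λ a → δₖ a₀ a * K) (allFin k)) (∑-+ _ _ (allFin k))) ⟨
      ∑ (λ a → 4 * k * k * edges a + k * k * (n * n) + δₖ a₀ a * K) (allFin k)
        ≤⟨ ∑-mono (allFin k) (λ a → pointwise a (h a)) ⟩
      ∑ (λ a → 4 * k * k * inside a + K + δₖ a₀ a * E) (allFin k)
        ≡⟨ trans (∑-+ _ _ (allFin k)) (cong (_+ ∑ (λ a → δₖ a₀ a * E) (allFin k)) (∑-+ _ _ (allFin k))) ⟩
      ∑ (λ a → 4 * k * k * inside a) (allFin k) + ∑ (λ _ → K) (allFin k) + ∑ (λ a → δₖ a₀ a * E) (allFin k)
        ≡⟨ cong₂ _+_ (cong₂ _+_ (∑-*ˡ (4 * k * k) inside (allFin k)) (∑-constₖ K)) (∑-δ E) ⟩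
      4 * k * k * ∑ inside (allFin k) + k * K + E
        ≡⟨ collect (4 * k * k) (∑ inside (allFin k)) (k * K) (n * O) (k * k * (n * n)) ⟩
      4 * k * k * (∑ inside (allFin k) + n * O) + k * K + k * k * (n * n)
        ≤⟨ +-monoˡ-≤ (k * k * (n * n)) (+-monoˡ-≤ (k * K) (*-monoʳ-≤ (4 * k * k) ∑-inside)) ⟩
      4 * k * k * (n * N) + k * K + k * k * (n * n) ∎)
      where
      open ≤-Reasoning
      collect : ∀ q s a o b → q * s + a + (q * o + b) ≡ q * (s + o) + a + b
      collect = solve-∀

  absurd : ⊥
  absurd = [ all-sparse , (λ { (a₀ , cl) → Base.impossible a₀ cl Colour.sparse⊎clustered }) ]′
    (choose {P = Colour.Sparse} {Q = Colour.Clustered} (allFin k) Colour.sparse⊎clustered)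

theorem1 : (k n : ℕ) → 4 ≤ k → 64 * k ≤ n →
    Σ ℕ λ N → Arrows k n N × (4 * k) * N ≤ (4 * k * k ∸ k + 2) * n
theorem1 k n 4≤k n-large with m≤n⇒∃[o]m+o≡n 4≤k
... | j , refl = N , arrows , subst (λ t → 4 * (4 + j) * N ≤ t * n) (sym coefficient) ≤A
  where
  C = coeff j
  -- The largest integer that the bound permits; rounding down loses less than 1, whence the 4k in
  -- `A≤`.
  N = C * n / (4 * (4 + j))
  coefficient : 4 * (4 + j) * (4 + j) ∸ (4 + j) + 2 ≡ C
  coefficient = trans (cong (λ t → t ∸ (4 + j) + 2) (expand j))
    (trans (cong (_+ 2) (m+n∸n≡m (60 + 31 * j + 4 * (j * j)) (4 + j))) (+-comm _ 2))
    where
    expand : ∀ j → 4 * (4 + j) * (4 + j) ≡ 60 + 31 * j + 4 * (j * j) + (4 + j)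
    expand = solve-∀
  ≤A : 4 * (4 + j) * N ≤ C * n
  ≤A = ≤-trans (≤-reflexive (*-comm (4 * (4 + j)) N)) (m/n*n≤m (C * n) (4 * (4 + j)))
  A≤ : C * n ≤ 4 * (4 + j) * N + 4 * (4 + j)
  A≤ = begin
    C * n                                               ≡⟨ m≡m%n+[m/n]*n (C * n) (4 * (4 + j)) ⟩
    C * n % (4 * (4 + j)) + N * (4 * (4 + j))           ≤⟨ +-mono-≤ (<⇒≤ (m%n<n (C * n) (4 * (4 + j)))) (≤-reflexive (*-comm N (4 * (4 + j)))) ⟩
    4 * (4 + j) + 4 * (4 + j) * N                       ≡⟨ +-comm (4 * (4 + j)) _ ⟩
    4 * (4 + j) * N + 4 * (4 + j)                       ∎
    where open ≤-Reasoning
  arrows : Arrows (4 + j) n N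
  arrows c = decide (any? (λ a → ∃-list? n (Colours.path? c a)))
    where
    decide : Dec (∃ λ a → ∃ λ l → length l ≡ n × Colours.Path c a l) → MonoPath c n
    decide (yes (a , l , len , path)) = subst (MonoPath c) len (Colours.path⇒monoPath c l path)
    decide (no none) = ⊥-elim (NoPath.absurd (4 + j) j n N refl n-large ≤A A≤ c
      (λ a l len path → none (a , l , len , path)))
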